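{- Let $t$ be a nonnegative integer, and let $G$ be a sparse-dense graph with respect to classes $\mathcal S$ (sparse) and $\mathcal D$ (dense), such that $\mathcal D$ is a subclass of the class of $\overline{K_t}$-free graphs, and $\mathcal S$ is a graph class that is recognizable in $T_1(n)$ time on $n$-vertex graphs and for whose $n$-vertex members all maximal independent sets can be enumerated in $T_2(n)$ time. Then all maximal independent sets of $G$ can be enumerated in $(T_1(n)+T_2(n))\cdot n^{\mathcal{O}(t)}$ time, where $n=|V(G)|$.
   Context: Graphs are finite, simple and undirected. Classes $\mathcal S$ and $\mathcal D$ of graphs are called classes of sparse and dense graphs, respectively, if both are closed under taking induced subgraphs and there is a constant $c$ (depending only on the two fixed classes) such that $|S\cap D|\le c$ for any $S\in\mathcal S$ and $D\in\mathcal D$ (here $S$, $D$ are identified with vertex subsets, of a common graph, inducing graphs in the respective class). A sparse-dense partition of a graph $G$ with respect to $\mathcal S$ and $\mathcal D$ is a partition $V(G)=S\cup D$ into two disjoint parts such that $S\in\mathcal S$ and $D\in\mathcal D$ (i.e., the induced subgraphs $G[S]$, $G[D]$ belong to $\mathcal S$, $\mathcal D$). A graph admitting such a partition is called a sparse-dense graph with respect to $\mathcal S$ and $\mathcal D$. A graph is $\overline{K_t}$-free if it has no independent set of size $t$ (equivalently, its complement is $K_t$-free). A maximal independent set is an independent set not properly contained in another independent set. The input of the algorithm is the graph $G$; no sparse-dense partition is given.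
   Formalization: The time bounds T_1 and T_2 are assumed nondecreasing; without this the claim fails, e.g. for S = all graphs on at most m vertices and D = graphs on at most one vertex, at n = m+1. -}

module Defs where

open import Data.Bool.Base using (Bool; true; false)
open import Data.Fin.Base using (Fin; zero; suc)
open import Data.Fin.Subset using (Subset; inside; outside; ∣_∣; _∈_; _⊂_; _∩_; _∪_; ⊤; ⊥)
open import Data.List.Base using (List; []; _∷_; tabulate)
open import Data.List.Membership.Propositional using () renaming (_∈_ to _∈ˡ_)
open import Data.List.Relation.Unary.Unique.Propositional using (Unique)
open import Data.Nat.Base using (ℕ; suc; _+_; _≤_)
open import Data.Product.Base using (∃; ∃₂; _×_)
open import Data.Vec.Base using (_∷_; toList)
open import Function.Bundles using (_⇔_)
open import Function.Definitions using (Injective)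
open import Level using (Level; _⊔_)
open import Relation.Binary.PropositionalEquality using (_≡_; _≢_)
open import Relation.Nullary using (¬_; Dec; does)
open import Relation.Unary using (Pred)

private variable
  ℓ ℓ₁ ℓ₂ : Level

record Graph : Set where
  field
    order  : ℕ
    adj    : Fin order → Fin order → Bool
    symm   : ∀ u v → adj u v ≡ adj v u
    irrefl : ∀ v → adj v v ≡ false

open Graph public

VertexSet : Graph → Set
VertexSet G = Subset (order G)

Independent : (G : Graph) → VertexSet G → Set
Independent G A = ∀ {u v} → u ∈ A → v ∈ A → adj G u v ≡ false

MaximalIndependent : (G : Graph) → VertexSet G → Set
MaximalIndependent G A = Independent G A × (∀ B → Independent G B → ¬ (A ⊂ B))

K̄-free : ℕ → Pred Graph _
K̄-free t G = ∀ A → Independent G A → ∣ A ∣ ≢ t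

-- The members of a vertex set in increasing order.
member : ∀ {n} (A : Subset n) → Fin ∣ A ∣ → Fin n
member (inside  ∷ A) zero    = zero
member (inside  ∷ A) (suc i) = suc (member A i)
member (outside ∷ A) i       = suc (member A i)

_[_] : (G : Graph) → VertexSet G → Graph
G [ A ] = record
  { order  = ∣ A ∣
  ; adj    = λ i j → adj G (member A i) (member A j)
  ; symm   = λ i j → symm G (member A i) (member A j)
  ; irrefl = λ i → irrefl G (member A i)
  }

-- H is, up to relabelling of vertices, an induced subgraph of G.
_≤ᵢ_ : Graph → Graph → Set
H ≤ᵢ G = ∃ λ (f : Fin (order H) → Fin (order G)) →
  Injective _≡_ _≡_ f × (∀ u v → adj H u v ≡ adj G (f u) (f v))

-- In particular, a hereditary class is closed under isomorphism.
Hereditary : Pred Graph ℓ → Set ℓ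
Hereditary 𝒞 = ∀ G H → H ≤ᵢ G → 𝒞 G → 𝒞 H

record SparseDenseClasses (𝒮 : Pred Graph ℓ₁) (𝒟 : Pred Graph ℓ₂) (c : ℕ) : Set (ℓ₁ ⊔ ℓ₂) where
  field
    sparse-hereditary : Hereditary 𝒮
    dense-hereditary  : Hereditary 𝒟
    ∣S∩D∣≤c           : ∀ G (S D : VertexSet G) → 𝒮 (G [ S ]) → 𝒟 (G [ D ]) → ∣ S ∩ D ∣ ≤ c

SparseDensePartition : Pred Graph ℓ₁ → Pred Graph ℓ₂ →
                       (G : Graph) → VertexSet G → VertexSet G → Set (ℓ₁ ⊔ ℓ₂)
SparseDensePartition 𝒮 𝒟 G S D =
  S ∪ D ≡ ⊤ × S ∩ D ≡ ⊥ × 𝒮 (G [ S ]) × 𝒟 (G [ D ])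

SparseDense : Pred Graph ℓ₁ → Pred Graph ℓ₂ → Pred Graph (ℓ₁ ⊔ ℓ₂)
SparseDense 𝒮 𝒟 G = ∃₂ λ S D → SparseDensePartition 𝒮 𝒟 G S D

-- Model of computation: a WHILE language over binary trees, in the style of
-- N. Jones, "Computability and Complexity: From a Programming Perspective".
-- Trees are the only data and every operation has unit cost.  This is realistic
-- because `pair` copies nothing: results can be shared by pointers, there is
-- no primitive equality test, and every operation inspects or allocates at
-- most one cell.

infixr 5 _∙_
data Tree : Set where
  nil : Tree
  _∙_ : Tree → Tree → Tree

infixr 4 _⨾_
data Program : Set where
  id nil head tail : Program
  pair             : Program → Program → Program
  _⨾_              : Program → Program → Program
  if_then_else_    : Program → Program → Program → Program
  while_loop_      : Program → Program → Program

-- p ⊢ x ⇓ y [ k ]: on input x, program p halts with output y after k steps.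
-- As a truth value, nil is false and every other tree is true.
infix 3 _⊢_⇓_[_]
data _⊢_⇓_[_] : Program → Tree → Tree → ℕ → Set where
  ⇓-id         : ∀ {x} → id ⊢ x ⇓ x [ 1 ]
  ⇓-nil        : ∀ {x} → nil ⊢ x ⇓ nil [ 1 ]
  ⇓-head-nil   : head ⊢ nil ⇓ nil [ 1 ]
  ⇓-head-∙     : ∀ {x y} → head ⊢ x ∙ y ⇓ x [ 1 ]
  ⇓-tail-nil   : tail ⊢ nil ⇓ nil [ 1 ]
  ⇓-tail-∙     : ∀ {x y} → tail ⊢ x ∙ y ⇓ y [ 1 ]
  ⇓-pair       : ∀ {p q x y z k l} →
                 p ⊢ x ⇓ y [ k ] → q ⊢ x ⇓ z [ l ] →
                 pair p q ⊢ x ⇓ y ∙ z [ suc (k + l) ]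
  ⇓-⨾          : ∀ {p q x y z k l} →
                 p ⊢ x ⇓ y [ k ] → q ⊢ y ⇓ z [ l ] →
                 (p ⨾ q) ⊢ x ⇓ z [ suc (k + l) ]
  ⇓-if-true    : ∀ {p q r x u v y k l} →
                 p ⊢ x ⇓ u ∙ v [ k ] → q ⊢ x ⇓ y [ l ] →
                 (if p then q else r) ⊢ x ⇓ y [ suc (k + l) ]
  ⇓-if-false   : ∀ {p q r x y k l} →
                 p ⊢ x ⇓ nil [ k ] → r ⊢ x ⇓ y [ l ] →
                 (if p then q else r) ⊢ x ⇓ y [ suc (k + l) ]
  ⇓-while-stop : ∀ {p q x k} →
                 p ⊢ x ⇓ nil [ k ] →
                 (while p loop q) ⊢ x ⇓ x [ suc k ]
  ⇓-while-step : ∀ {p q x u v y z k l m} →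
                 p ⊢ x ⇓ u ∙ v [ k ] → q ⊢ x ⇓ y [ l ] → (while p loop q) ⊢ y ⇓ z [ m ] →
                 (while p loop q) ⊢ x ⇓ z [ suc (k + l + m) ]

_⊢_⇓_within_ : Program → Tree → Tree → ℕ → Set
p ⊢ x ⇓ y within τ = ∃ λ k → p ⊢ x ⇓ y [ k ] × k ≤ τ

encodeBool : Bool → Tree
encodeBool false = nil
encodeBool true  = nil ∙ nil

encodeList : ∀ {a} {A : Set a} → (A → Tree) → List A → Tree
encodeList enc []       = nil
encodeList enc (x ∷ xs) = enc x ∙ encodeList enc xs

-- A graph is given by its adjacency matrix, a vertex set by its characteristic vector.
encodeGraph : Graph → Tree
encodeGraph G = encodeList (encodeList encodeBool) (tabulate λ u → tabulate λ v → adj G u v)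

encodeSubset : ∀ {n} → Subset n → Tree
encodeSubset A = encodeList encodeBool (toList A)

RecognizableInTime : (ℕ → ℕ) → Pred Graph ℓ → Set ℓ
RecognizableInTime τ 𝒞 = ∃ λ p → ∀ G → ∃ λ (d : Dec (𝒞 G)) →
  p ⊢ encodeGraph G ⇓ encodeBool (does d) within τ (order G)

-- The list contains every maximal independent set exactly once, and nothing else.
ListsMaximalIndependentSets : (G : Graph) → List (VertexSet G) → Set
ListsMaximalIndependentSets G As = Unique As × (∀ A → A ∈ˡ As ⇔ MaximalIndependent G A)

-- Nothing is required of the program on graphs outside 𝒞.
MISEnumerableInTime : (ℕ → ℕ) → Pred Graph ℓ → Set ℓ
MISEnumerableInTime τ 𝒞 = ∃ λ p → ∀ G → 𝒞 G → ∃ λ As →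
  ListsMaximalIndependentSets G As ×
  p ⊢ encodeGraph G ⇓ encodeList encodeSubset As within τ (order G)

{-# OPTIONS --safe #-}

-- Let S₀, D₀ be a sparse-dense partition of G.  Members of 𝒟 cannot be recognised, so the algorithm
-- looks for a sparse set S such that no t vertices outside S are independent.  A sparse S has at most c
-- vertices outside S₀; hence if |S| < |S₀|, exchanging at most 2c + 1 vertices of S yields a larger
-- sparse set, and once |S| ≥ |S₀|, S₀ itself is obtained from S by exchanging at most 2c vertices.
--
-- A maximal independent set A is then the union of I = A ∖ S, which has fewer than t elements, and of a
-- maximal independent set J of G[S ∖ N(I)].  Distinct pairs (I , J) have distinct unions, and a union A
-- is maximal independent if and only if N(A) is the complement of A.
--
-- Times are measured as W * M ^ e with W = T₁ n + T₂ n and M = n ^ t.  The factor W occurs only once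
-- because a list computed in k steps has at most k entries more than its input is deep.

module Submission where

open import Defs
open import Data.Bool.Base using (Bool; true; false; not; _∧_; _∨_; _xor_; T) renaming (if_then_else_ to ifᵇ_then_else_)
open import Data.Bool.ListAction using (all)
open import Data.Bool.Properties using (¬-not)
open import Data.Empty using (⊥-elim)
open import Data.Fin.Base using (Fin; zero; suc)
open import Data.Fin.Properties using (suc-injective)
open import Data.Fin.Subset using (Subset; inside; outside; ∣_∣; _∈_; _∉_; _∪_; _∩_; ⊥; ⁅_⁆) renaming (_⊆_ to _⊆ˢ_)
open import Data.Fin.Subset.Properties
open import Data.List.Base as List using (List; []; _∷_)
open import Data.List.Membership.Propositional using () renaming (_∈_ to _∈ˡ_; _∉_ to _∉ˡ_)
open import Data.List.Membership.Propositional.Properties using (∈-map⁺; ∈-map⁻)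
open import Data.List.Relation.Unary.All as All using (All; []; _∷_)
open import Data.List.Relation.Unary.AllPairs using ([]; _∷_)
open import Data.List.Relation.Unary.Any using (here; there)
open import Data.List.Relation.Unary.Unique.Propositional using (Unique)
open import Data.Nat.Base using (ℕ; zero; suc; pred; _+_; _*_; _^_; _∸_; _⊔_; _≤_; _<_; _<ᵇ_; z≤n; s≤s; NonZero; >-nonZero)
open import Data.Nat.Properties hiding (suc-injective)
open import Data.Nat.Tactic.RingSolver using (solve-∀)
open import Data.Product.Base using (∃; _×_; _,_; proj₁; proj₂)
open import Data.Sum.Base using (_⊎_; inj₁; inj₂; [_,_]′)
open import Data.Vec.Base as Vec using (Vec; []; _∷_; toList; fromList; zipWith; lookup; tabulate)
open import Data.Vec.Properties using (toList∘fromList; lookup-map; lookup∘tabulate; tabulate∘lookup; tabulate-cong; tabulate-∘; lookup⇒[]=; []=⇒lookup; lookup-zipWith)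
open import Function.Base using (_∘_; case_of_)
open import Function.Bundles using (mk⇔; Equivalence)
open import Level using (Level)
open import Relation.Binary.Definitions using (Monotonic₁)
open import Relation.Binary.PropositionalEquality hiding ([_])
open import Relation.Nullary using (Dec; yes; no; does)
open import Relation.Nullary.Decidable using (dec-true)
open import Relation.Unary using (Pred; _⊆_)

-- The exponent has to be fixed before the classes, their programs and t are known. It is therefore
-- read off the syntax of the program. In that syntax t occurs only as the numeral built by
-- `budgetᶜ`, whose time is annotated by hand; otherwise t acts through M alone. The number 2c + 1
-- comes from |S ⊕ Y| = |Y| - |S| + 2 |S - Y|. If Y contains the part of S inside S₀, then S - Y
-- lies outside S₀ and has at most c elements, while |Y| exceeds |S| by at most 1. Neither S₀ nor
-- its size is known to the algorithm. Starting from the empty set, n rounds suffice, since each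
-- round gains a vertex until |S₀| is reached. Afterwards S₀ cannot be told apart from other sets
-- near S, so any set near S with the two useful properties is accepted. An enumerated list can have
-- about W entries, so a loop over it whose rounds were also charged W would cost W squared. The
-- bodies of these loops call neither the recogniser nor the enumerator and are analysed with W = 1.

infixr 5 _∙ᶜ_
infixr 4 _⨾ᶜ_

-- Programs annotated with bounds: code p e stands for a program p that runs in time W * M ^ e, and
-- whileᶜ d for a loop with at most M ^ d rounds.
data Code : Set where
  code                  : Program → ℕ → Code
  idᶜ nilᶜ headᶜ tailᶜ : Code
  _∙ᶜ_ _⨾ᶜ_             : Code → Code → Code
  ifᶜ                   : Code → Code → Code → Code
  whileᶜ                : ℕ → Code → Code

-- On l ∙ s ∙ γ, the loop replaces s by the value of its body on x ∙ s ∙ γ for each entry x of l.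
program : Code → Program
program (code p _)      = p
program idᶜ             = id
program nilᶜ            = nil
program headᶜ           = head
program tailᶜ           = tail
program (p ∙ᶜ q)        = pair (program p) (program q)
program (p ⨾ᶜ q)        = program p ⨾ program q
program (ifᶜ p q r)     = if program p then program q else program r
program (whileᶜ d body) = while head loop
  pair (head ⨾ tail) (pair (pair (head ⨾ head) tail ⨾ program body) (tail ⨾ tail))

-- The added constants pay for unit costs: as `2 ≤ M`, a sum of two terms costs one more power of M.
-- Being syntactic, the exponent is the same for all inputs and all W.
exponent : Code → ℕ
exponent (code _ e)      = e
exponent idᶜ             = 0
exponent nilᶜ            = 0
exponent headᶜ           = 0
exponent tailᶜ           = 0
exponent (p ∙ᶜ q)        = 2 + (exponent p + exponent q)
exponent (p ⨾ᶜ q)        = 2 + (exponent p + exponent q)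
exponent (ifᶜ p q r)     = 2 + (exponent p + (exponent q + exponent r))
exponent (whileᶜ d body) = 6 + (d + exponent body)

-- Environments are lists of trees, var i being their i-th entry.
hdᶜ tlᶜ ↑_ : Code → Code
hdᶜ p = p ⨾ᶜ headᶜ
tlᶜ p = p ⨾ᶜ tailᶜ
↑ p   = tailᶜ ⨾ᶜ p

infix 9 ↑_

var : ℕ → Code
var zero    = headᶜ
var (suc i) = ↑ var i

letᶜ : Code → Code → Code
letᶜ p q = p ∙ᶜ idᶜ ⨾ᶜ q

loopᶜ : ℕ → Code → Code → Code → Code
loopᶜ d xs s body = xs ∙ᶜ s ∙ᶜ idᶜ ⨾ᶜ whileᶜ d body ⨾ᶜ var 1

-- A loop walks along one list only, so the second list is carried in the state, in front of the
-- pairs made so far. Zipping a list with itself is how a single list gets folded.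
zipᶜ : ℕ → Code → Code → Code
zipᶜ d xs ys = tlᶜ (loopᶜ d xs (ys ∙ᶜ nilᶜ)
  (tlᶜ (hdᶜ (var 1)) ∙ᶜ (var 0 ∙ᶜ hdᶜ (hdᶜ (var 1))) ∙ᶜ tlᶜ (var 1)))

-- A right fold, because zipᶜ lists the pairs in reverse order.
foldᶜ : ℕ → Code → Code → Code → Code → Code
foldᶜ d xs ys init body = loopᶜ d (zipᶜ d xs ys) init body

-- Running times of annotated programs and of their loops.

hd tl : Tree → Tree
hd nil     = nil
hd (x ∙ y) = x
tl nil     = nil
tl (x ∙ y) = y

tls : ℕ → Tree → Tree
tls zero    x = x
tls (suc i) x = tls i (tl x)

truth : Tree → Bool
truth nil     = false
truth (_ ∙ _) = true

encodeVec : ∀ {a n} {A : Set a} → (A → Tree) → Vec A n → Tree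
encodeVec enc xs = encodeList enc (toList xs)

module _ {a b : Level} {A : Set a} {B : Set b} (encA : A → Tree) (encB : B → Tree) where

  revZip : ∀ {n} → Vec A n → Vec B n → Tree → Tree
  revZip []       []       acc = acc
  revZip (x ∷ xs) (y ∷ ys) acc = revZip xs ys ((encA x ∙ encB y) ∙ acc)

module Run {M W : ℕ} (2≤M : 2 ≤ M) (1≤W : 1 ≤ W) where

  -- The wrapper keeps `p` inferable: it could not be recovered from `program p`, which is a
  -- computed value.
  infix 3 _⊩_⇓_
  record _⊩_⇓_ (p : Code) (x y : Tree) : Set where
    constructor halts
    field halting : program p ⊢ x ⇓ y within (W * M ^ exponent p)

  instance
    M-nonZero : NonZero M
    M-nonZero = >-nonZero (≤-trans (s≤s z≤n) 2≤M)

  pow-mono : ∀ {d e} → d ≤ e → W * M ^ d ≤ W * M ^ e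
  pow-mono d≤e = *-monoʳ-≤ W (^-monoʳ-≤ M d≤e)

  1≤pow : ∀ e → 1 ≤ W * M ^ e
  1≤pow e = *-mono-≤ 1≤W (m^n>0 M e)

  sum≤pow : ∀ {a b} e → a ≤ W * M ^ e → b ≤ W * M ^ e → a + b ≤ W * M ^ suc e
  sum≤pow {a} {b} e a≤ b≤ = begin
    a + b                     ≤⟨ +-mono-≤ a≤ b≤ ⟩
    W * M ^ e + W * M ^ e     ≡⟨ double W (M ^ e) ⟩
    W * (2 * M ^ e)           ≤⟨ *-monoʳ-≤ W (*-monoˡ-≤ (M ^ e) 2≤M) ⟩
    W * M ^ suc e             ∎
    where
    open ≤-Reasoning
    double : ∀ w m → w * m + w * m ≡ w * (2 * m)
    double = solve-∀

  suc-sum≤pow : ∀ {a b} d e → a ≤ W * M ^ d → b ≤ W * M ^ e →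
                suc (a + b) ≤ W * M ^ (2 + (d + e))
  suc-sum≤pow d e a≤ b≤ = sum≤pow (suc (d + e)) (1≤pow (suc (d + e)))
    (sum≤pow (d + e) (≤-trans a≤ (pow-mono (m≤m+n d e))) (≤-trans b≤ (pow-mono (m≤n+m e d))))

  private variable
    p q r : Code
    x y z γ : Tree

  within-exponent : ∀ {k} → program p ⊢ x ⇓ y [ k ] → k ≤ W * M ^ exponent p → p ⊩ x ⇓ y
  within-exponent run k≤ = halts (_ , run , k≤)

  id⇓ : idᶜ ⊩ x ⇓ x
  id⇓ = within-exponent ⇓-id (1≤pow 0)

  nil⇓ : nilᶜ ⊩ x ⇓ nil
  nil⇓ = within-exponent ⇓-nil (1≤pow 0)

  head⇓ : headᶜ ⊩ x ⇓ hd x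
  head⇓ {nil}   = within-exponent ⇓-head-nil (1≤pow 0)
  head⇓ {_ ∙ _} = within-exponent ⇓-head-∙ (1≤pow 0)

  tail⇓ : tailᶜ ⊩ x ⇓ tl x
  tail⇓ {nil}   = within-exponent ⇓-tail-nil (1≤pow 0)
  tail⇓ {_ ∙ _} = within-exponent ⇓-tail-∙ (1≤pow 0)

  infixr 5 _∙⇓_
  infixr 4 _⨾⇓_

  _∙⇓_ : p ⊩ x ⇓ y → q ⊩ x ⇓ z → p ∙ᶜ q ⊩ x ⇓ y ∙ z
  _∙⇓_ {p} {q = q} (halts (_ , run₁ , ≤₁)) (halts (_ , run₂ , ≤₂)) =
    within-exponent (⇓-pair run₁ run₂) (suc-sum≤pow (exponent p) (exponent q) ≤₁ ≤₂)

  _⨾⇓_ : p ⊩ x ⇓ y → q ⊩ y ⇓ z → p ⨾ᶜ q ⊩ x ⇓ z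
  _⨾⇓_ {p} {q = q} (halts (_ , run₁ , ≤₁)) (halts (_ , run₂ , ≤₂)) =
    within-exponent (⇓-⨾ run₁ run₂) (suc-sum≤pow (exponent p) (exponent q) ≤₁ ≤₂)

  if⇓ : p ⊩ x ⇓ y → (truth y ≡ true → q ⊩ x ⇓ z) → (truth y ≡ false → r ⊩ x ⇓ z) →
        ifᶜ p q r ⊩ x ⇓ z
  if⇓ {p} {y = _ ∙ _} {q} {r = r} (halts (_ , run₁ , ≤₁)) onTrue _ with halts (_ , run₂ , ≤₂) ← onTrue refl =
    within-exponent (⇓-if-true run₁ run₂)
      (suc-sum≤pow (exponent p) (exponent q + exponent r) ≤₁ (≤-trans ≤₂ (pow-mono (m≤m+n (exponent q) (exponent r)))))
  if⇓ {p} {y = nil} {q} {r = r} (halts (_ , run₁ , ≤₁)) _ onFalse with halts (_ , run₂ , ≤₂) ← onFalse refl =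
    within-exponent (⇓-if-false run₁ run₂)
      (suc-sum≤pow (exponent p) (exponent q + exponent r) ≤₁ (≤-trans ≤₂ (pow-mono (m≤n+m (exponent r) (exponent q)))))

  choose⇓ : ∀ {a} {A : Set a} (enc : A → Tree) b {u v} → p ⊩ x ⇓ encodeBool b →
            q ⊩ x ⇓ enc u → r ⊩ x ⇓ enc v → ifᶜ p q r ⊩ x ⇓ enc (ifᵇ b then u else v)
  choose⇓ enc true  p⇓ q⇓ r⇓ = if⇓ p⇓ (λ _ → q⇓) λ ()
  choose⇓ enc false p⇓ q⇓ r⇓ = if⇓ p⇓ (λ ()) λ _ → r⇓

  cast⇓ : y ≡ z → p ⊩ x ⇓ y → p ⊩ x ⇓ z
  cast⇓ refl p⇓ = p⇓

  hd⇓ : p ⊩ x ⇓ y → hdᶜ p ⊩ x ⇓ hd y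
  hd⇓ p⇓ = p⇓ ⨾⇓ head⇓

  tl⇓ : p ⊩ x ⇓ y → tlᶜ p ⊩ x ⇓ tl y
  tl⇓ p⇓ = p⇓ ⨾⇓ tail⇓

  infix 9 ↑⇓_
  ↑⇓_ : p ⊩ x ⇓ y → ↑ p ⊩ z ∙ x ⇓ y
  ↑⇓ p⇓ = tail⇓ ⨾⇓ p⇓

  var⇓ : ∀ i → var i ⊩ x ⇓ hd (tls i x)
  var⇓ zero    = head⇓
  var⇓ (suc i) = tail⇓ ⨾⇓ var⇓ i

  let⇓ : p ⊩ x ⇓ y → q ⊩ y ∙ x ⇓ z → letᶜ p q ⊩ x ⇓ z
  let⇓ p⇓ q⇓ = p⇓ ∙⇓ id⇓ ⨾⇓ q⇓

  data Iterates (body : Code) (γ : Tree) : ℕ → Tree → Tree → Tree → Set where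
    stop : ∀ {s} → Iterates body γ 0 nil s s
    step : ∀ {j x l s s′ r} → body ⊩ x ∙ s ∙ γ ⇓ s′ → Iterates body γ j l s′ r →
           Iterates body γ (suc j) (x ∙ l) s r

  -- The 2 pays for the final failing test, the 16 for the test of one round together with unpacking
  -- and rebuilding the state.
  iterates-halts : ∀ {body j l s r} d → Iterates body γ j l s r →
                   program (whileᶜ d body) ⊢ l ∙ s ∙ γ ⇓ nil ∙ r ∙ γ
                     within (2 + j * (16 + W * M ^ exponent body))
  iterates-halts d stop = _ , ⇓-while-stop ⇓-head-∙ , ≤-refl
  iterates-halts {body = body} {suc j} d (step (halts (b , run , b≤)) iter)
    with k , runs , k≤ ← iterates-halts d iter =
    _ ,
    ⇓-while-step ⇓-head-∙
      (⇓-pair (⇓-⨾ ⇓-head-∙ ⇓-tail-∙)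
        (⇓-pair (⇓-⨾ (⇓-pair (⇓-⨾ ⇓-head-∙ ⇓-head-∙) ⇓-tail-∙) run) (⇓-⨾ ⇓-tail-∙ ⇓-tail-∙)))
      runs ,
    (begin
      _                                  ≡⟨ steps b k ⟩
      (16 + b) + k                       ≤⟨ +-mono-≤ (+-monoʳ-≤ 16 b≤) k≤ ⟩
      (16 + B) + (2 + j * (16 + B))      ≡⟨ regroup B (j * (16 + B)) ⟩
      2 + suc j * (16 + B)               ∎)
    where
    open ≤-Reasoning
    B = W * M ^ exponent body
    steps : ∀ b k → 1 + (1 + (1 + (3 + (1 + (1 + (5 + b) + 3)))) + k) ≡ (16 + b) + k
    steps = solve-∀
    regroup : ∀ B r → (16 + B) + (2 + r) ≡ 2 + ((16 + B) + r)
    regroup = solve-∀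

  -- Four doublings give 16 j, and one further sum each adds `j * B` and 2, hence the 6 in
  -- `exponent`. The product `j * B` is bounded as a whole, so that the factor W may come either
  -- from the body or from the number of rounds.
  loop-bound : ∀ j d e {B} → j ≤ W * M ^ d → j * B ≤ W * M ^ (d + e) →
               2 + j * (16 + B) ≤ W * M ^ (6 + (d + e))
  loop-bound j d e {B} j≤ jB≤ = begin
    2 + j * (16 + B)                   ≡⟨ regroup j B ⟩
    (1 + 1) + (dup (dup (dup (dup j))) + j * B)
      ≤⟨ sum≤pow (5 + (d + e)) (≤-trans (sum≤pow 0 (1≤pow 0) (1≤pow 0)) (pow-mono {1} {5 + (d + e)} (s≤s z≤n)))
           (sum≤pow (4 + (d + e))
             (dup≤ (3 + (d + e)) (dup≤ (2 + (d + e)) (dup≤ (1 + (d + e)) (dup≤ (d + e)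
               (≤-trans j≤ (pow-mono (m≤m+n d e)))))))
             (≤-trans jB≤ (pow-mono (m≤n+m (d + e) 4)))) ⟩
    W * M ^ (6 + (d + e))              ∎
    where
    open ≤-Reasoning
    dup : ℕ → ℕ
    dup a = a + a
    dup≤ : ∀ {a} e → a ≤ W * M ^ e → dup a ≤ W * M ^ suc e
    dup≤ e a≤ = sum≤pow e a≤ a≤
    regroup : ∀ j B → 2 + j * (16 + B) ≡
      (1 + 1) + ((((j + j) + (j + j)) + ((j + j) + (j + j)) + (((j + j) + (j + j)) + ((j + j) + (j + j)))) + j * B)
    regroup = solve-∀

  while⇓ : ∀ {body j l s r} d → Iterates body γ j l s r → j ≤ M ^ d →
           whileᶜ d body ⊩ l ∙ s ∙ γ ⇓ nil ∙ r ∙ γ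
  while⇓ {body = body} {j} d iter j≤ with k , run , k≤ ← iterates-halts d iter =
    within-exponent run (≤-trans k≤ (loop-bound j d (exponent body)
      (≤-trans j≤ (m≤n*m (M ^ d) W))
      (begin
        j * (W * M ^ e)        ≤⟨ *-monoˡ-≤ (W * M ^ e) j≤ ⟩
        M ^ d * (W * M ^ e)    ≡⟨ regroup (M ^ d) W (M ^ e) ⟩
        W * (M ^ d * M ^ e)    ≡⟨ cong (W *_) (^-distribˡ-+-* M d e) ⟨
        W * M ^ (d + e)        ∎)))
    where
    open ≤-Reasoning
    e = exponent body
    instance _ = >-nonZero 1≤W
    regroup : ∀ a b c → a * (b * c) ≡ b * (a * c)
    regroup = solve-∀

  loop⇓ : ∀ {xs s l s₀ body j r} d → xs ⊩ γ ⇓ l → s ⊩ γ ⇓ s₀ →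
          Iterates body γ j l s₀ r → j ≤ M ^ d → loopᶜ d xs s body ⊩ γ ⇓ r
  loop⇓ d xs⇓ s⇓ iter j≤ = (xs⇓ ∙⇓ s⇓ ∙⇓ id⇓) ⨾⇓ while⇓ d iter j≤ ⨾⇓ var⇓ 1

  module _ {a b : Level} {A : Set a} {B : Set b} {encA : A → Tree} {encB : B → Tree} where

    iterates-zip : ∀ {n} (xs : Vec A n) (ys : Vec B n) acc →
      Iterates (tlᶜ (hdᶜ (var 1)) ∙ᶜ (var 0 ∙ᶜ hdᶜ (hdᶜ (var 1))) ∙ᶜ tlᶜ (var 1)) γ n
        (encodeVec encA xs) (encodeVec encB ys ∙ acc) (nil ∙ revZip encA encB xs ys acc)
    iterates-zip []       []       acc = stop
    iterates-zip (x ∷ xs) (y ∷ ys) acc =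
      step (tl⇓ (hd⇓ (var⇓ 1)) ∙⇓ (var⇓ 0 ∙⇓ hd⇓ (hd⇓ (var⇓ 1))) ∙⇓ tl⇓ (var⇓ 1))
           (iterates-zip xs ys _)

    zip⇓ : ∀ {n} d {as bs} (xs : Vec A n) (ys : Vec B n) → n ≤ M ^ d →
           as ⊩ γ ⇓ encodeVec encA xs → bs ⊩ γ ⇓ encodeVec encB ys →
           zipᶜ d as bs ⊩ γ ⇓ revZip encA encB xs ys nil
    zip⇓ d xs ys n≤ as⇓ bs⇓ = tl⇓ (loop⇓ d as⇓ (bs⇓ ∙⇓ nil⇓) (iterates-zip xs ys nil) n≤)

    -- F gives the value of the accumulator after a pair of suffixes has been processed.
    module _ {body : Code} (F : ∀ {j} → Vec A j → Vec B j → Tree) where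

      -- The pairs are listed in reverse, so the state passes through longer and longer suffixes.
      -- The premise `j < n` serves bodies whose bounds are known only for proper suffixes, such as
      -- the list lengths in `items⇓`.
      iterates-revZip : ∀ {n k l r} (xs : Vec A n) (ys : Vec B n) →
        (∀ {j} x y (xs : Vec A j) (ys : Vec B j) → j < n →
          body ⊩ (encA x ∙ encB y) ∙ F xs ys ∙ γ ⇓ F (x ∷ xs) (y ∷ ys)) →
        Iterates body γ k l (F xs ys) r →
        Iterates body γ (n + k) (revZip encA encB xs ys l) (F [] []) r
      iterates-revZip []       []       _     rest = rest
      iterates-revZip {γ = γ} {n = suc n} {k} {l} {r} (x ∷ xs) (y ∷ ys) body⇓ rest =
        subst (λ m → Iterates body γ m (revZip encA encB xs ys ((encA x ∙ encB y) ∙ l)) (F [] []) r) (+-suc n k)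
          (iterates-revZip xs ys (λ x y xs ys j<n → body⇓ x y xs ys (m<n⇒m<1+n j<n))
            (step (body⇓ x y xs ys (n<1+n n)) rest))

      loop-revZip⇓ : ∀ {n} d {ps init} (xs : Vec A n) (ys : Vec B n) → n ≤ M ^ d →
        ps ⊩ γ ⇓ revZip encA encB xs ys nil → init ⊩ γ ⇓ F [] [] →
        (∀ {j} x y (xs : Vec A j) (ys : Vec B j) → j < n →
          body ⊩ (encA x ∙ encB y) ∙ F xs ys ∙ γ ⇓ F (x ∷ xs) (y ∷ ys)) →
        loopᶜ d ps init body ⊩ γ ⇓ F xs ys
      loop-revZip⇓ {n = n} d xs ys n≤ ps⇓ init⇓ body⇓ =
        loop⇓ d ps⇓ init⇓ (iterates-revZip xs ys body⇓ stop)
          (≤-trans (≤-reflexive (+-identityʳ n)) n≤)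

      fold⇓ : ∀ {n} d {as bs init} (xs : Vec A n) (ys : Vec B n) → n ≤ M ^ d →
        as ⊩ γ ⇓ encodeVec encA xs → bs ⊩ γ ⇓ encodeVec encB ys → init ⊩ γ ⇓ F [] [] →
        (∀ {j} x y (xs : Vec A j) (ys : Vec B j) → j < n →
          body ⊩ (encA x ∙ encB y) ∙ F xs ys ∙ γ ⇓ F (x ∷ xs) (y ∷ ys)) →
        foldᶜ d as bs init body ⊩ γ ⇓ F xs ys
      fold⇓ d xs ys n≤ as⇓ bs⇓ = loop-revZip⇓ d xs ys n≤ (zip⇓ d xs ys n≤ as⇓ bs⇓)

  foldList⇓ : ∀ {a} {A : Set a} {enc : A → Tree} {body} (F : List A → Tree) d {as init}
    (xs : List A) → List.length xs ≤ M ^ d →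
    as ⊩ γ ⇓ encodeList enc xs → init ⊩ γ ⇓ F [] →
    (∀ x z xs → body ⊩ (enc x ∙ z) ∙ F xs ∙ γ ⇓ F (x ∷ xs)) →
    foldᶜ d as as init body ⊩ γ ⇓ F xs
  foldList⇓ {enc = enc} F d xs ≤M^d as⇓ init⇓ body⇓ =
    subst (λ ys → _ ⊩ _ ⇓ F ys) (toList∘fromList xs)
      (fold⇓ (λ ys _ → F (toList ys)) d (fromList xs) (fromList xs) ≤M^d as⇓′ as⇓′ init⇓
        λ x y ys _ _ → body⇓ x (enc y) (toList ys))
    where
    as⇓′ = subst (λ ys → _ ⊩ _ ⇓ encodeList enc ys) (sym (toList∘fromList xs)) as⇓

-- Loops with W * M ^ d rounds, each of which takes time M ^ e.
module LongLoops {M W : ℕ} (2≤M : 2 ≤ M) (1≤W : 1 ≤ W) where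

  open Run {M} {W} 2≤M 1≤W
  module Short = Run {M} {1} 2≤M ≤-refl

  private variable
    γ : Tree

  longLoop⇓ : ∀ {xs s l s₀ body j r} d → xs ⊩ γ ⇓ l → s ⊩ γ ⇓ s₀ →
              Short.Iterates body γ j l s₀ r → j ≤ W * M ^ d → loopᶜ d xs s body ⊩ γ ⇓ r
  longLoop⇓ {body = body} {j} d xs⇓ s⇓ iter j≤
    with k , run , k≤ ← Short.iterates-halts d iter =
    (xs⇓ ∙⇓ s⇓ ∙⇓ id⇓) ⨾⇓
    within-exponent run (≤-trans k≤ (loop-bound j d e j≤ (begin
      j * (1 * M ^ e)        ≤⟨ *-monoˡ-≤ (1 * M ^ e) j≤ ⟩
      W * M ^ d * (1 * M ^ e) ≡⟨ regroup W (M ^ d) (M ^ e) ⟩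
      W * (M ^ d * M ^ e)    ≡⟨ cong (W *_) (^-distribˡ-+-* M d e) ⟨
      W * M ^ (d + e)        ∎))) ⨾⇓
    var⇓ 1
    where
    open ≤-Reasoning
    e = exponent body
    regroup : ∀ w a b → w * a * (1 * b) ≡ w * (a * b)
    regroup = solve-∀

  longFoldList⇓ : ∀ {a} {A : Set a} {enc : A → Tree} {body} (F : List A → Tree) d {as init}
    (xs : List A) → List.length xs ≤ W * M ^ d →
    as ⊩ γ ⇓ encodeList enc xs → init ⊩ γ ⇓ F [] →
    (∀ x z xs → body Short.⊩ (enc x ∙ z) ∙ F xs ∙ γ ⇓ F (x ∷ xs)) →
    foldᶜ d as as init body ⊩ γ ⇓ F xs
  longFoldList⇓ {enc = enc} F d xs ≤W as⇓ init⇓ body⇓ =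
    subst (λ ys → _ ⊩ _ ⇓ F ys) (toList∘fromList xs)
      -- Zipping the list is a long loop as well, and its body too is run with W = 1.
      (longLoop⇓ d (tl⇓ (longLoop⇓ d as⇓′ (as⇓′ ∙⇓ nil⇓) (Short.iterates-zip ys ys nil) ≤W)) init⇓
        (Short.iterates-revZip (λ ys _ → F (toList ys)) ys ys
          (λ x y ys _ _ → body⇓ x (enc y) (toList ys)) Short.stop)
        (≤-trans (≤-reflexive (+-identityʳ _)) ≤W))
    where
    ys = fromList xs
    as⇓′ = subst (λ ys → _ ⊩ _ ⇓ encodeList enc ys) (sym (toList∘fromList xs)) as⇓

-- The algorithm as functions on bit vectors.

infixl 6 _∖_ _⊕_

_∖_ _⊕_ : ∀ {n} → Subset n → Subset n → Subset n
_∖_ = zipWith λ x y → x ∧ not y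
_⊕_ = zipWith _xor_

meets : ∀ {n} → Subset n → Subset n → Bool
meets []      []      = false
meets (x ∷ A) (y ∷ B) = (x ∧ y) ∨ meets A B

complementary : ∀ {n} → Subset n → Subset n → Bool
complementary []      []      = true
complementary (x ∷ A) (y ∷ B) = (x xor y) ∧ complementary A B

compress : ∀ {a n} {A : Set a} (X : Subset n) → Vec A n → Vec A ∣ X ∣
compress []            []       = []
compress (inside  ∷ X) (x ∷ xs) = x ∷ compress X xs
compress (outside ∷ X) (x ∷ xs) = compress X xs

expand : ∀ {n} (X : Subset n) → Subset ∣ X ∣ → Subset n
expand []            []      = []
expand (inside  ∷ X) (y ∷ J) = y ∷ expand X J
expand (outside ∷ X) J       = outside ∷ expand X J

-- An item (b , v) is a set v together with the number b of vertices it may still receive.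
Item : ℕ → Set
Item n = ℕ × Subset n

extend : ∀ {n} → List (Item n) → List (Item (suc n))
extend []                  = []
extend ((zero  , v) ∷ its) = (zero , outside ∷ v) ∷ extend its
extend ((suc b , v) ∷ its) = (suc b , outside ∷ v) ∷ (b , inside ∷ v) ∷ extend its

-- Every item satisfies b + |v| = k, and every set of at most k vertices occurs once. The items with
-- budget zero are thus the sets of exactly k vertices, so one list serves for both purposes and no
-- program has to count.
items : ∀ n → ℕ → List (Item n)
items zero    k = (k , []) ∷ []
items (suc n) k = extend (items n k)

Matrix : ℕ → Set
Matrix n = Vec (Vec Bool n) n

neighbours : ∀ {m n} → Vec (Vec Bool n) m → Subset n → Subset m
neighbours rows A = Vec.map (λ row → meets row A) rows

submatrix : ∀ {m n} (X : Subset m) (Y : Subset n) → Vec (Vec Bool n) m → Vec (Vec Bool ∣ Y ∣) ∣ X ∣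
submatrix X Y rows = Vec.map (compress Y) (compress X rows)

module Enumeration {n : ℕ} (rows : Matrix n) where

  -- For the items of `items n t`, budget zero means exactly t vertices; such a set must meet C or
  -- contain an edge, the latter being expressed by `meets (neighbours rows v) v`. Smaller sets
  -- impose nothing.
  harmless : Subset n → Item n → Bool
  harmless C (zero  , v) = meets v C ∨ meets (neighbours rows v) v
  harmless C (suc _ , v) = true

  allowed : Subset n → Subset n → Subset n
  allowed S I = S ∖ neighbours rows I

  maximal : Subset n → Bool
  maximal A = complementary (neighbours rows A) A

  -- J is maximal among the vertices of X only, so a vertex outside S may still extend the union,
  -- and the filter is needed. It also discards every I that is not independent. The list grows in
  -- front of `rest`, which avoids appending.
  extensions : (I X : Subset n) → List (Subset ∣ X ∣) → List (Subset n) → List (Subset n)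
  extensions I X []       rest = rest
  extensions I X (J ∷ Js) rest =
    ifᵇ maximal (I ∪ expand X J) then I ∪ expand X J ∷ extensions I X Js rest
                                 else extensions I X Js rest

  collect : (S : Subset n) → (∀ I → List (Subset ∣ allowed S I ∣)) → List (Item n) → List (Subset n)
  collect S enum []              = []
  collect S enum ((_ , I) ∷ its) =
    -- If I were allowed to meet S, one union could arise from several I.
    ifᵇ meets I S then collect S enum its
                  else extensions I (allowed S I) (enum I) (collect S enum its)

module Search {n : ℕ} (rows : Matrix n) (sparse : Subset n → Bool) where

  open Enumeration rows

  -- As v runs through the small sets, `S ⊕ v` runs through all sets near S. One list of masks,
  -- computed once, therefore describes the exchanges at every S.
  best : Subset n → List (Item n) → Subset n
  best S []               = S
  best S ((_ , v) ∷ its) =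
    ifᵇ ∣ best S its ∣ <ᵇ ∣ S ⊕ v ∣
    then (ifᵇ sparse (S ⊕ v) then S ⊕ v else best S its)
    else best S its

  improved : List (Item n) → ℕ → Subset n
  improved masks zero    = ⊥
  improved masks (suc j) = best (improved masks j) masks

  pick : List (Item n) → Subset n → List (Item n) → Subset n
  -- A default: some mask qualifies whenever the graph has a sparse-dense partition.
  pick its S []                = S
  pick its S ((_ , v) ∷ masks) =
    ifᵇ sparse (S ⊕ v)
    then (ifᵇ all (harmless (S ⊕ v)) its then S ⊕ v else pick its S masks)
    else pick its S masks

-- The algorithm as annotated programs.

unary : ℕ → Tree
unary zero    = nil
unary (suc k) = nil ∙ unary k

encodeItem : ∀ {n} → Item n → Tree
encodeItem (b , v) = unary b ∙ encodeSubset v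

encodeRows : ∀ {m n} → Vec (Vec Bool n) m → Tree
encodeRows = encodeVec (encodeVec encodeBool)

boolᶜ : Bool → Code
boolᶜ true  = nilᶜ ∙ᶜ nilᶜ
boolᶜ false = nilᶜ

-- The first entry of the environment is a pair of Booleans.
caseᶜ : Code → Code → Code → Code → Code
caseᶜ tt tf ft ff = ifᶜ (hdᶜ (var 0)) (ifᶜ (tlᶜ (var 0)) tt tf) (ifᶜ (tlᶜ (var 0)) ft ff)

zipWithᶜ : (Bool → Bool → Bool) → Code → Code → Code
zipWithᶜ f a b = foldᶜ 1 a b nilᶜ
  (caseᶜ (boolᶜ (f true true)) (boolᶜ (f true false)) (boolᶜ (f false true)) (boolᶜ (f false false))
    ∙ᶜ var 1)

-- The loop body that takes the state J ∙ acc from a set X and J : Subset ∣ X ∣ to revZip X (expand X J).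
spreadᶜ : Code
spreadᶜ = ifᶜ (var 0)
  (tlᶜ (hdᶜ (var 1)) ∙ᶜ (var 0 ∙ᶜ hdᶜ (hdᶜ (var 1))) ∙ᶜ tlᶜ (var 1))
  (hdᶜ (var 1) ∙ᶜ (var 0 ∙ᶜ boolᶜ false) ∙ᶜ tlᶜ (var 1))

meetsᶜ complementaryᶜ compressᶜ neighboursᶜ submatrixᶜ expandᶜ : Code → Code → Code
meetsᶜ a b         = foldᶜ 1 a b (boolᶜ false) (caseᶜ (boolᶜ true) (var 1) (var 1) (var 1))
complementaryᶜ a b = foldᶜ 1 a b (boolᶜ true) (caseᶜ (boolᶜ false) (var 1) (var 1) (boolᶜ false))
compressᶜ x as     = foldᶜ 1 x as nilᶜ (ifᶜ (hdᶜ (var 0)) (tlᶜ (var 0) ∙ᶜ var 1) (var 1))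
neighboursᶜ g a    = foldᶜ 1 g g nilᶜ (meetsᶜ (hdᶜ (var 0)) (↑ ↑ a) ∙ᶜ var 1)
submatrixᶜ g x     = foldᶜ 1 x g nilᶜ
  (ifᶜ (hdᶜ (var 0)) (compressᶜ (↑ ↑ x) (tlᶜ (var 0)) ∙ᶜ var 1) (var 1))
expandᶜ x j        = loopᶜ 1 (tlᶜ (loopᶜ 1 x (j ∙ᶜ nilᶜ) spreadᶜ)) nilᶜ (tlᶜ (var 0) ∙ᶜ var 1)

emptyᶜ sizeᶜ : Code → Code
emptyᶜ g = foldᶜ 1 g g nilᶜ (boolᶜ false ∙ᶜ var 1)
sizeᶜ a  = foldᶜ 1 a a nilᶜ (ifᶜ (hdᶜ (var 0)) (nilᶜ ∙ᶜ var 1) (var 1))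

excessᶜ : Code → Code → Code
excessᶜ k a = foldᶜ 1 a a k (ifᶜ (hdᶜ (var 0)) (tlᶜ (var 1)) (var 1))

-- A bare program, because as `Code` its exponent would grow with the numeral, hence with t. Its
-- time is bounded separately in `budget⇓`.
budgetᶜ : ℕ → Program
budgetᶜ zero    = nil
budgetᶜ (suc k) = pair nil (budgetᶜ k)

extendᶜ : ℕ → Code → Code
extendᶜ d its = foldᶜ d its its nilᶜ
  (ifᶜ budget
    ((budget ∙ᶜ boolᶜ false ∙ᶜ set) ∙ᶜ (tlᶜ budget ∙ᶜ boolᶜ true ∙ᶜ set) ∙ᶜ var 1)
    ((budget ∙ᶜ boolᶜ false ∙ᶜ set) ∙ᶜ var 1))
  where
  budget set : Code
  budget = hdᶜ (hdᶜ (var 0))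
  set    = tlᶜ (hdᶜ (var 0))

-- The rows of the matrix serve as a counter for n rounds, as they do in `emptyᶜ` and `improvedᶜ`.
itemsᶜ : ℕ → ℕ → Code → Code
itemsᶜ d k g = foldᶜ 1 g g ((code (budgetᶜ k) (d + d) ∙ᶜ nilᶜ) ∙ᶜ nilᶜ) (extendᶜ d (var 1))

bestᶜ : ℕ → Code → Code → Code → Code → Code
bestᶜ d recog g s masks = foldᶜ d masks masks s
  (letᶜ (zipWithᶜ _xor_ (↑ ↑ s) (tlᶜ (hdᶜ (var 0))))
    -- Sizes are compared by truncated subtraction in unary: the excess is nil exactly if the
    -- candidate has at least one vertex more than the current best, so a true value keeps the
    -- latter.
    (ifᶜ (excessᶜ (nilᶜ ∙ᶜ sizeᶜ (var 2)) (var 0))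
      (var 2)
      (ifᶜ (submatrixᶜ (↑ ↑ ↑ g) (var 0) ⨾ᶜ recog) (var 0) (var 2))))

improvedᶜ : ℕ → Code → Code → Code → Code
improvedᶜ d recog g masks = foldᶜ 1 g g (emptyᶜ g) (bestᶜ d recog (↑ ↑ g) (var 1) (↑ ↑ masks))

harmlessᶜ : ℕ → Code → Code → Code → Code
harmlessᶜ d g its c = foldᶜ d its its (boolᶜ true)
  (ifᶜ (hdᶜ (hdᶜ (var 0))) (var 1)
    (ifᶜ (meetsᶜ set (↑ ↑ c)) (var 1)
      (ifᶜ (meetsᶜ (neighboursᶜ (↑ ↑ g) set) set) (var 1) (boolᶜ false))))
  where
  set : Code
  set = tlᶜ (hdᶜ (var 0))

pickᶜ : ℕ → ℕ → Code → Code → Code → Code → Code → Code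
pickᶜ dₘ d recog g its s masks = foldᶜ dₘ masks masks s
  (letᶜ (zipWithᶜ _xor_ (↑ ↑ s) (tlᶜ (hdᶜ (var 0))))
    (ifᶜ (submatrixᶜ (↑ ↑ ↑ g) (var 0) ⨾ᶜ recog)
      (ifᶜ (harmlessᶜ d (↑ ↑ ↑ g) (↑ ↑ ↑ its) (var 0)) (var 0) (var 2))
      (var 2)))

extensionᶜ : Code → Code → Code → Code
extensionᶜ g i x = letᶜ (zipWithᶜ _∨_ (↑ ↑ i) (expandᶜ (↑ ↑ x) (hdᶜ (var 0))))
  (ifᶜ (complementaryᶜ (neighboursᶜ (↑ ↑ ↑ g) (var 0)) (var 0)) (var 0 ∙ᶜ var 2) (var 2))

extensionsᶜ : ℕ → Code → Code → Code → Code → Code → Code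
extensionsᶜ d g i x js rest = foldᶜ d js js rest
  (extensionᶜ g i x)

collectᶜ : ℕ → ℕ → Code → Code → Code → Code → Code
collectᶜ d dₑ enumerate g s its = foldᶜ d its its nilᶜ
  (ifᶜ (meetsᶜ set (↑ ↑ s)) (var 1)
    (letᶜ (zipWithᶜ (λ x y → x ∧ not y) (↑ ↑ s) (neighboursᶜ (↑ ↑ g) set))
      (extensionsᶜ dₑ (↑ ↑ ↑ g) (↑ set) (var 0)
        (submatrixᶜ (↑ ↑ ↑ g) (var 0) ⨾ᶜ enumerate) (var 2))))
  where
  set : Code
  set = tlᶜ (hdᶜ (var 0))

-- Environment: the adjacency matrix, then masks, items, and the successive sparse sets.
mainᶜ : ℕ → Program → Program → ℕ → Code
mainᶜ c recogniser enumerator t =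
  idᶜ ∙ᶜ nilᶜ ⨾ᶜ
  letᶜ (itemsᶜ dₘ (suc (2 * c)) (var 0))
  (letᶜ (itemsᶜ 2 t (var 1))
  (letᶜ (improvedᶜ dₘ recog (var 2) (var 1))
  (letᶜ (pickᶜ dₘ 2 recog (var 3) (var 1) (var 0) (var 2))
  -- There are at most M ^ 2 sets I by `items-t≤`, and at most W * M ^ 4 sets J for each of them by
  -- `enum≤`.
  (collectᶜ 2 4 (code enumerator 0) (var 4) (var 0) (var 2)))))
  where
  -- At most (n + 1) ^ (2c + 1) masks exist, and n + 1 ≤ M ^ 2.
  dₘ = 2 * suc (2 * c)
  recog = code recogniser 0

-- Values and running times of the programs.

<ᵇ-unary : ∀ a b → truth (unary (suc a ∸ b)) ≡ not (a <ᵇ b)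
<ᵇ-unary a       zero    = refl
<ᵇ-unary zero    (suc b) = cong (λ k → truth (unary k)) (0∸n≡0 b)
<ᵇ-unary (suc a) (suc b) = <ᵇ-unary a b

module SetRoutines {M W n : ℕ} (2≤M : 2 ≤ M) (1≤W : 1 ≤ W) (n≤M : n ≤ M) where

  open Run {M} {W} 2≤M 1≤W

  private variable
    x γ : Tree
    A B C : Code

  n≤M¹ : n ≤ M ^ 1
  n≤M¹ = ≤-trans n≤M (≤-reflexive (sym (*-identityʳ M)))

  bool⇓ : ∀ b → boolᶜ b ⊩ γ ⇓ encodeBool b
  bool⇓ true  = nil⇓ ∙⇓ nil⇓
  bool⇓ false = nil⇓

  if-bool⇓ : ∀ {p q r x y} b → p ⊩ x ⇓ encodeBool b → (b ≡ true → q ⊩ x ⇓ y) → (b ≡ false → r ⊩ x ⇓ y) →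
             ifᶜ p q r ⊩ x ⇓ y
  if-bool⇓ true  p⇓ q⇓ r⇓ = if⇓ p⇓ (λ _ → q⇓ refl) λ ()
  if-bool⇓ false p⇓ q⇓ r⇓ = if⇓ p⇓ (λ ()) λ _ → r⇓ refl

  case⇓ : ∀ {tt tf ft ff} (f : Bool → Bool → Tree) u v →
    tt ⊩ (encodeBool u ∙ encodeBool v) ∙ γ ⇓ f true true →
    tf ⊩ (encodeBool u ∙ encodeBool v) ∙ γ ⇓ f true false →
    ft ⊩ (encodeBool u ∙ encodeBool v) ∙ γ ⇓ f false true →
    ff ⊩ (encodeBool u ∙ encodeBool v) ∙ γ ⇓ f false false →
    caseᶜ tt tf ft ff ⊩ (encodeBool u ∙ encodeBool v) ∙ γ ⇓ f u v
  case⇓ f u v tt tf ft ff = if-bool⇓ u (hd⇓ (var⇓ 0))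
    (λ { refl → if-bool⇓ v (tl⇓ (var⇓ 0)) (λ { refl → tt }) (λ { refl → tf }) })
    (λ { refl → if-bool⇓ v (tl⇓ (var⇓ 0)) (λ { refl → ft }) (λ { refl → ff }) })

  zipWith⇓ : ∀ f (X Y : Subset n) → A ⊩ γ ⇓ encodeSubset X → B ⊩ γ ⇓ encodeSubset Y →
             zipWithᶜ f A B ⊩ γ ⇓ encodeSubset (zipWith f X Y)
  zipWith⇓ f X Y A⇓ B⇓ = fold⇓ (λ X Y → encodeSubset (zipWith f X Y)) 1 X Y n≤M¹ A⇓ B⇓ nil⇓
    λ u v _ _ _ → case⇓ (λ u v → encodeBool (f u v)) u v (bool⇓ _) (bool⇓ _) (bool⇓ _) (bool⇓ _)
      ∙⇓ var⇓ 1

  meets⇓ : ∀ (X Y : Subset n) → A ⊩ γ ⇓ encodeSubset X → B ⊩ γ ⇓ encodeSubset Y →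
           meetsᶜ A B ⊩ γ ⇓ encodeBool (meets X Y)
  meets⇓ X Y A⇓ B⇓ = fold⇓ (λ X Y → encodeBool (meets X Y)) 1 X Y n≤M¹ A⇓ B⇓ (bool⇓ false)
    λ u v X Y _ → case⇓ (λ u v → encodeBool ((u ∧ v) ∨ meets X Y)) u v
      (bool⇓ true) (var⇓ 1) (var⇓ 1) (var⇓ 1)

  complementary⇓ : ∀ (X Y : Subset n) → A ⊩ γ ⇓ encodeSubset X → B ⊩ γ ⇓ encodeSubset Y →
                   complementaryᶜ A B ⊩ γ ⇓ encodeBool (complementary X Y)
  complementary⇓ X Y A⇓ B⇓ =
    fold⇓ (λ X Y → encodeBool (complementary X Y)) 1 X Y n≤M¹ A⇓ B⇓ (bool⇓ true)
    λ u v X Y _ → case⇓ (λ u v → encodeBool ((u xor v) ∧ complementary X Y)) u v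
      (bool⇓ false) (var⇓ 1) (var⇓ 1) (bool⇓ false)

  compress⇓ : ∀ {ℓ} {T : Set ℓ} {enc : T → Tree} (X : Subset n) (xs : Vec T n) →
    A ⊩ γ ⇓ encodeSubset X → B ⊩ γ ⇓ encodeVec enc xs →
    compressᶜ A B ⊩ γ ⇓ encodeVec enc (compress X xs)
  compress⇓ {enc = enc} X xs A⇓ B⇓ =
    fold⇓ (λ X xs → encodeVec enc (compress X xs)) 1 X xs n≤M¹ A⇓ B⇓ nil⇓
    λ { true  _ _ _ _ → if⇓ (hd⇓ (var⇓ 0)) (λ _ → tl⇓ (var⇓ 0) ∙⇓ var⇓ 1) λ ()
      ; false _ _ _ _ → if⇓ (hd⇓ (var⇓ 0)) (λ ()) λ _ → var⇓ 1 }

  neighbours⇓ : ∀ (rows : Matrix n) (X : Subset n) → A ⊩ γ ⇓ encodeRows rows → B ⊩ γ ⇓ encodeSubset X →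
    neighboursᶜ A B ⊩ γ ⇓ encodeSubset (neighbours rows X)
  neighbours⇓ rows X A⇓ B⇓ =
    fold⇓ (λ rows _ → encodeSubset (neighbours rows X)) 1 rows rows n≤M¹ A⇓ A⇓ nil⇓
    λ row _ _ _ _ → meets⇓ row X (hd⇓ (var⇓ 0)) (↑⇓ ↑⇓ B⇓) ∙⇓ var⇓ 1

  submatrix⇓ : ∀ (rows : Matrix n) (X : Subset n) → A ⊩ γ ⇓ encodeRows rows → B ⊩ γ ⇓ encodeSubset X →
    submatrixᶜ A B ⊩ γ ⇓ encodeRows (submatrix X X rows)
  submatrix⇓ rows X A⇓ B⇓ =
    fold⇓ (λ Y rows → encodeRows (submatrix Y X rows)) 1 X rows n≤M¹ B⇓ A⇓ nil⇓
    λ { true  row _ _ _ → if⇓ (hd⇓ (var⇓ 0))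
          (λ _ → compress⇓ X row (↑⇓ ↑⇓ B⇓) (tl⇓ (var⇓ 0)) ∙⇓ var⇓ 1) λ ()
      ; false row _ _ _ → if⇓ (hd⇓ (var⇓ 0)) (λ ()) λ _ → var⇓ 1 }

  -- J has entries only for the members of X, so the two lists advance at different speeds and
  -- `zipᶜ` does not apply. The first loop spreads J along X in reverse order, the second one
  -- restores the order.
  expand⇓ : ∀ (X : Subset n) (J : Subset ∣ X ∣) → A ⊩ γ ⇓ encodeSubset X → B ⊩ γ ⇓ encodeSubset J →
            expandᶜ A B ⊩ γ ⇓ encodeSubset (expand X J)
  expand⇓ {γ = γ} X J A⇓ B⇓ =
    loop-revZip⇓ (λ _ Y → encodeSubset Y) 1 X (expand X J) n≤M¹
      (tl⇓ (loop⇓ 1 A⇓ (B⇓ ∙⇓ nil⇓) (iterates X J nil) n≤M¹)) nil⇓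
      λ _ _ _ _ _ → tl⇓ (var⇓ 0) ∙⇓ var⇓ 1
    where
    iterates : ∀ {m} (X : Subset m) (J : Subset ∣ X ∣) acc →
      Iterates spreadᶜ γ m (encodeSubset X) (encodeSubset J ∙ acc)
        (nil ∙ revZip encodeBool encodeBool X (expand X J) acc)
    iterates []          []      acc = stop
    iterates (true ∷ X)  (y ∷ J) acc = step
      (if⇓ (var⇓ 0)
        (λ _ → tl⇓ (hd⇓ (var⇓ 1)) ∙⇓ (var⇓ 0 ∙⇓ hd⇓ (hd⇓ (var⇓ 1))) ∙⇓ tl⇓ (var⇓ 1)) λ ())
      (iterates X J _)
    iterates (false ∷ X) J       acc = step
      (if⇓ (var⇓ 0) (λ ()) λ _ → hd⇓ (var⇓ 1) ∙⇓ (var⇓ 0 ∙⇓ bool⇓ false) ∙⇓ tl⇓ (var⇓ 1))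
      (iterates X J _)

  empty⇓ : (rows : Matrix n) → A ⊩ γ ⇓ encodeRows rows → emptyᶜ A ⊩ γ ⇓ encodeSubset {n} ⊥
  empty⇓ rows A⇓ = fold⇓ (λ {j} _ _ → encodeSubset {j} ⊥) 1 rows rows n≤M¹ A⇓ A⇓ nil⇓
    λ _ _ _ _ _ → bool⇓ false ∙⇓ var⇓ 1

  size⇓ : ∀ (X : Subset n) → A ⊩ γ ⇓ encodeSubset X → sizeᶜ A ⊩ γ ⇓ unary ∣ X ∣
  size⇓ X A⇓ = fold⇓ (λ X _ → unary ∣ X ∣) 1 X X n≤M¹ A⇓ A⇓ nil⇓
    λ { true  _ _ _ _ → if⇓ (hd⇓ (var⇓ 0)) (λ _ → nil⇓ ∙⇓ var⇓ 1) λ ()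
      ; false _ _ _ _ → if⇓ (hd⇓ (var⇓ 0)) (λ ()) λ _ → var⇓ 1 }

  tl-unary : ∀ k → tl (unary k) ≡ unary (pred k)
  tl-unary zero    = refl
  tl-unary (suc k) = refl

  excess⇓ : ∀ k (X : Subset n) → A ⊩ γ ⇓ unary k → B ⊩ γ ⇓ encodeSubset X →
            excessᶜ A B ⊩ γ ⇓ unary (k ∸ ∣ X ∣)
  excess⇓ k X A⇓ B⇓ = fold⇓ (λ X _ → unary (k ∸ ∣ X ∣)) 1 X X n≤M¹ B⇓ B⇓ A⇓
    λ { true  _ X _ _ → cast⇓
          (trans (tl-unary (k ∸ ∣ X ∣)) (cong unary (pred[m∸n]≡m∸[1+n] k ∣ X ∣)))
          (if⇓ (hd⇓ (var⇓ 0)) (λ _ → tl⇓ (var⇓ 1)) λ ())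
      ; false _ _ _ _ → if⇓ (hd⇓ (var⇓ 0)) (λ ()) λ _ → var⇓ 1 }

  -- The linear time 1 + 2k is at most 4 ^ k. Comparing it with a power of 2 gives an exponent that
  -- does not grow with k = t, as t is itself an exponent in M.
  budget⇓ : ∀ k d → 2 ^ k ≤ M ^ d → code (budgetᶜ k) (d + d) ⊩ γ ⇓ unary k
  budget⇓ k d 2^k≤ = within-exponent (budget-run k) (begin
    1 + 2 * k                ≤⟨ bound k ⟩
    2 ^ k * 2 ^ k            ≤⟨ *-mono-≤ 2^k≤ 2^k≤ ⟩
    M ^ d * M ^ d            ≡⟨ ^-distribˡ-+-* M d d ⟨
    M ^ (d + d)              ≤⟨ m≤n*m (M ^ (d + d)) W ⟩
    W * M ^ (d + d)          ∎)
    where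
    open ≤-Reasoning
    instance _ = >-nonZero 1≤W
    budget-run : ∀ {γ} k → budgetᶜ k ⊢ γ ⇓ unary k [ 1 + 2 * k ]
    budget-run zero    = ⇓-nil
    budget-run {γ} (suc k) = subst (budgetᶜ (suc k) ⊢ γ ⇓ unary (suc k) [_]) (count k) (⇓-pair ⇓-nil (budget-run k))
      where
      count : ∀ k → suc (1 + (1 + 2 * k)) ≡ 1 + 2 * suc k
      count = solve-∀
    bound : ∀ k → 1 + 2 * k ≤ 2 ^ k * 2 ^ k
    bound zero    = ≤-refl
    bound (suc k) = begin
      1 + 2 * suc k                  ≡⟨ lhs k ⟩
      2 + (1 + 2 * k)                ≤⟨ +-mono-≤ (+-mono-≤ 1≤ 1≤) (bound k) ⟩
      (P + P) + P                    ≤⟨ m≤m+n _ P ⟩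
      ((P + P) + P) + P              ≡⟨ rhs (2 ^ k) ⟩
      2 ^ suc k * 2 ^ suc k          ∎
      where
      P = 2 ^ k * 2 ^ k
      1≤ : 1 ≤ P
      1≤ = *-mono-≤ (m^n>0 2 k) (m^n>0 2 k)
      lhs : ∀ k → 1 + 2 * suc k ≡ 2 + (1 + 2 * k)
      lhs = solve-∀
      rhs : ∀ p → ((p * p + p * p) + p * p) + p * p ≡ (2 * p) * (2 * p)
      rhs = solve-∀

  extend⇓ : ∀ {m} d (its : List (Item m)) → List.length its ≤ M ^ d →
            A ⊩ γ ⇓ encodeList encodeItem its → extendᶜ d A ⊩ γ ⇓ encodeList encodeItem (extend its)
  extend⇓ d its ≤M^d A⇓ = foldList⇓ (λ its → encodeList encodeItem (extend its)) d its ≤M^d A⇓ nil⇓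
    λ { (zero , v) _ its → if⇓ budget-run (λ ()) λ _ →
          (budget-run ∙⇓ bool⇓ false ∙⇓ set-run) ∙⇓ var⇓ 1
      ; (suc b , v) _ its → if⇓ budget-run
          (λ _ → (budget-run ∙⇓ bool⇓ false ∙⇓ set-run) ∙⇓ (tl⇓ budget-run ∙⇓ bool⇓ true ∙⇓ set-run) ∙⇓ var⇓ 1)
          λ () }
    where
    budget-run : hdᶜ (hdᶜ (var 0)) ⊩ x ⇓ hd (hd (hd x))
    budget-run = hd⇓ (hd⇓ (var⇓ 0))
    set-run : tlᶜ (hdᶜ (var 0)) ⊩ x ⇓ tl (hd (hd x))
    set-run = tl⇓ (hd⇓ (var⇓ 0))

  items⇓ : ∀ d k (rows : Matrix n) → 2 ^ k ≤ M ^ d →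
           (∀ {j} → j < n → List.length (items j k) ≤ M ^ d) →
           A ⊩ γ ⇓ encodeRows rows → itemsᶜ d k A ⊩ γ ⇓ encodeList encodeItem (items n k)
  items⇓ d k rows 2^k≤ length≤ A⇓ =
    fold⇓ (λ {j} _ _ → encodeList encodeItem (items j k)) 1 rows rows n≤M¹ A⇓ A⇓
      ((budget⇓ k d 2^k≤ ∙⇓ nil⇓) ∙⇓ nil⇓)
      λ {j} _ _ _ _ j<n → extend⇓ d (items j k) (length≤ j<n) (var⇓ 1)

  extension⇓ : ∀ (rows : Matrix n) I X J {x} Js rest → let open Enumeration rows in
    C ⊩ γ ⇓ encodeRows rows → A ⊩ γ ⇓ encodeSubset I → B ⊩ γ ⇓ encodeSubset X →
    extensionᶜ C A B ⊩ (encodeSubset J ∙ x) ∙ encodeList encodeSubset (extensions I X Js rest) ∙ γ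
      ⇓ encodeList encodeSubset (extensions I X (J ∷ Js) rest)
  extension⇓ rows I X J Js rest C⇓ A⇓ B⇓ = let⇓
    (zipWith⇓ _∨_ I (expand X J) (↑⇓ ↑⇓ A⇓) (expand⇓ X J (↑⇓ ↑⇓ B⇓) (hd⇓ (var⇓ 0))))
    (choose⇓ (encodeList encodeSubset) (Enumeration.maximal rows (I ∪ expand X J))
      (complementary⇓ (neighbours rows (I ∪ expand X J)) (I ∪ expand X J)
        (neighbours⇓ rows (I ∪ expand X J) (↑⇓ ↑⇓ ↑⇓ C⇓) (var⇓ 0)) (var⇓ 0))
      (var⇓ 0 ∙⇓ var⇓ 2) (var⇓ 2))

module SearchRoutines {M W n : ℕ} (2≤M : 2 ≤ M) (1≤W : 1 ≤ W) (n≤M : n ≤ M)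
  (recog : Code) (rows : Matrix n) (sparse : Subset n → Bool)
  (recog⇓ : ∀ X → Run._⊩_⇓_ 2≤M 1≤W recog (encodeRows (submatrix X X rows)) (encodeBool (sparse X))) where

  open Run {M} {W} 2≤M 1≤W
  open SetRoutines {M} {W} 2≤M 1≤W n≤M
  open Enumeration rows
  open Search rows sparse

  private variable
    γ : Tree
    A B C G : Code

  best⇓ : ∀ d S (masks : List (Item n)) → List.length masks ≤ M ^ d →
    G ⊩ γ ⇓ encodeRows rows → A ⊩ γ ⇓ encodeSubset S → B ⊩ γ ⇓ encodeList encodeItem masks →
    bestᶜ d recog G A B ⊩ γ ⇓ encodeSubset (best S masks)
  best⇓ d S masks length≤ G⇓ A⇓ B⇓ =
    foldList⇓ (λ masks → encodeSubset (best S masks)) d masks length≤ B⇓ A⇓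
      λ { (_ , v) _ masks → let⇓ (zipWith⇓ _xor_ S v (↑⇓ ↑⇓ A⇓) (tl⇓ (hd⇓ (var⇓ 0))))
            (compare (S ⊕ v) (best S masks)) }
    where
    compare : ∀ C D {x} →
      ifᶜ (excessᶜ (nilᶜ ∙ᶜ sizeᶜ (var 2)) (var 0)) (var 2)
          (ifᶜ (submatrixᶜ (↑ ↑ ↑ _) (var 0) ⨾ᶜ recog) (var 0) (var 2))
        ⊩ encodeSubset C ∙ x ∙ encodeSubset D ∙ _
        ⇓ encodeSubset (ifᵇ ∣ D ∣ <ᵇ ∣ C ∣ then (ifᵇ sparse C then C else D) else D)
    compare C D with ∣ D ∣ <ᵇ ∣ C ∣ | <ᵇ-unary ∣ D ∣ ∣ C ∣
    ... | true  | eq = if⇓ (excess⇓ (suc ∣ D ∣) C (nil⇓ ∙⇓ size⇓ D (var⇓ 2)) (var⇓ 0))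
            (λ eq′ → case trans (sym eq) eq′ of λ ())
            λ _ → choose⇓ encodeSubset (sparse C) (submatrix⇓ rows C (↑⇓ ↑⇓ ↑⇓ G⇓) (var⇓ 0) ⨾⇓ recog⇓ C)
              (var⇓ 0) (var⇓ 2)
    ... | false | eq = if⇓ (excess⇓ (suc ∣ D ∣) C (nil⇓ ∙⇓ size⇓ D (var⇓ 2)) (var⇓ 0))
            (λ _ → var⇓ 2) (λ eq′ → case trans (sym eq) eq′ of λ ())

  improved⇓ : ∀ d (masks : List (Item n)) → List.length masks ≤ M ^ d →
    G ⊩ γ ⇓ encodeRows rows → B ⊩ γ ⇓ encodeList encodeItem masks →
    improvedᶜ d recog G B ⊩ γ ⇓ encodeSubset (improved masks n)
  improved⇓ d masks length≤ G⇓ B⇓ =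
    fold⇓ (λ {j} _ _ → encodeSubset (improved masks j)) 1 rows rows n≤M¹ G⇓ G⇓ (empty⇓ rows G⇓)
      λ {j} _ _ _ _ _ → best⇓ d (improved masks j) masks length≤ (↑⇓ ↑⇓ G⇓) (var⇓ 1) (↑⇓ ↑⇓ B⇓)

  harmless⇓ : ∀ d C′ (its : List (Item n)) → List.length its ≤ M ^ d →
    G ⊩ γ ⇓ encodeRows rows → B ⊩ γ ⇓ encodeList encodeItem its → C ⊩ γ ⇓ encodeSubset C′ →
    harmlessᶜ d G B C ⊩ γ ⇓ encodeBool (all (harmless C′) its)
  harmless⇓ d X its length≤ G⇓ B⇓ C⇓ =
    foldList⇓ (λ its → encodeBool (all (harmless X) its)) d its length≤ B⇓ (bool⇓ true)
      λ { (suc _ , v) _ its → if⇓ (hd⇓ (hd⇓ (var⇓ 0))) (λ _ → var⇓ 1) λ ()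
        ; (zero , v) _ its → if⇓ (hd⇓ (hd⇓ (var⇓ 0))) (λ ()) λ _ →
            cast⇓ (cong encodeBool (conditional (meets v X) _ _))
            (choose⇓ encodeBool (meets v X) (meets⇓ v X (tl⇓ (hd⇓ (var⇓ 0))) (↑⇓ ↑⇓ C⇓)) (var⇓ 1)
              (choose⇓ encodeBool (meets (neighbours rows v) v)
                (meets⇓ (neighbours rows v) v
                  (neighbours⇓ rows v (↑⇓ ↑⇓ G⇓) (tl⇓ (hd⇓ (var⇓ 0)))) (tl⇓ (hd⇓ (var⇓ 0))))
                (var⇓ 1) (bool⇓ false))) }
    where
    conditional : ∀ x y z → (ifᵇ x then z else (ifᵇ y then z else false)) ≡ (x ∨ y) ∧ z
    conditional true  y     z = refl
    conditional false true  z = refl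
    conditional false false z = refl

  pick⇓ : ∀ d d′ S (its masks : List (Item n)) → List.length masks ≤ M ^ d → List.length its ≤ M ^ d′ →
    G ⊩ γ ⇓ encodeRows rows → C ⊩ γ ⇓ encodeList encodeItem its →
    A ⊩ γ ⇓ encodeSubset S → B ⊩ γ ⇓ encodeList encodeItem masks →
    pickᶜ d d′ recog G C A B ⊩ γ ⇓ encodeSubset (pick its S masks)
  pick⇓ d d′ S its masks masks≤ its≤ G⇓ C⇓ A⇓ B⇓ =
    foldList⇓ (λ masks → encodeSubset (pick its S masks)) d masks masks≤ B⇓ A⇓
      λ { (_ , v) _ masks → let⇓ (zipWith⇓ _xor_ S v (↑⇓ ↑⇓ A⇓) (tl⇓ (hd⇓ (var⇓ 0))))
            (choose⇓ encodeSubset (sparse (S ⊕ v))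
              (submatrix⇓ rows (S ⊕ v) (↑⇓ ↑⇓ ↑⇓ G⇓) (var⇓ 0) ⨾⇓ recog⇓ (S ⊕ v))
              (choose⇓ encodeSubset (all (harmless (S ⊕ v)) its)
                (harmless⇓ d′ (S ⊕ v) its its≤ (↑⇓ ↑⇓ ↑⇓ G⇓) (↑⇓ ↑⇓ ↑⇓ C⇓) (var⇓ 0))
                (var⇓ 0) (var⇓ 2))
              (var⇓ 2)) }

module EnumerationRoutines {M W n : ℕ} (2≤M : 2 ≤ M) (1≤W : 1 ≤ W) (n≤M : n ≤ M) (rows : Matrix n) where

  open Run {M} {W} 2≤M 1≤W
  open LongLoops {M} {W} 2≤M 1≤W
  open SetRoutines {M} {W} 2≤M 1≤W n≤M
  open Enumeration rows

  module ShortRoutines = SetRoutines {M} {1} 2≤M ≤-refl n≤M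

  private variable
    γ : Tree
    A B C D G : Code

  -- The rounds already contribute a factor W, so everything read inside a round must be available
  -- in the W = 1 measure. This is why `collect⇓` takes the matrix in both measures.
  extensions⇓ : ∀ d I X Js rest → List.length Js ≤ W * M ^ d →
    G Short.⊩ γ ⇓ encodeRows rows → A Short.⊩ γ ⇓ encodeSubset I → B Short.⊩ γ ⇓ encodeSubset X →
    C ⊩ γ ⇓ encodeList encodeSubset Js → D ⊩ γ ⇓ encodeList encodeSubset rest →
    extensionsᶜ d G A B C D ⊩ γ ⇓ encodeList encodeSubset (extensions I X Js rest)
  extensions⇓ d I X Js rest length≤ G⇓ A⇓ B⇓ C⇓ D⇓ =
    longFoldList⇓ (λ Js → encodeList encodeSubset (extensions I X Js rest)) d Js length≤ C⇓ D⇓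
      λ J _ Js → ShortRoutines.extension⇓ rows I X J Js rest G⇓ A⇓ B⇓

  collect⇓ : ∀ d dₑ (enumerator : Code) S (enum : ∀ I → List (Subset ∣ allowed S I ∣)) (its : List (Item n)) →
    (∀ I → List.length (enum I) ≤ W * M ^ dₑ) →
    (∀ I → enumerator ⊩ encodeRows (submatrix (allowed S I) (allowed S I) rows)
             ⇓ encodeList encodeSubset (enum I)) →
    List.length its ≤ M ^ d →
    G Short.⊩ γ ⇓ encodeRows rows → G ⊩ γ ⇓ encodeRows rows → A ⊩ γ ⇓ encodeSubset S →
    B ⊩ γ ⇓ encodeList encodeItem its →
    collectᶜ d dₑ enumerator G A B ⊩ γ ⇓ encodeList encodeSubset (collect S enum its)
  collect⇓ d dₑ enumerator S enum its enum≤ enumerator⇓ length≤ G⇓₁ G⇓ A⇓ B⇓ =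
    foldList⇓ (λ its → encodeList encodeSubset (collect S enum its)) d its length≤ B⇓ nil⇓
      λ { (_ , I) _ its → choose⇓ (encodeList encodeSubset) (meets I S)
            (meets⇓ I S (tl⇓ (hd⇓ (var⇓ 0))) (↑⇓ ↑⇓ A⇓))
            (var⇓ 1)
            (let⇓ (zipWith⇓ (λ x y → x ∧ not y) S (neighbours rows I) (↑⇓ ↑⇓ A⇓)
                    (neighbours⇓ rows I (↑⇓ ↑⇓ G⇓) (tl⇓ (hd⇓ (var⇓ 0)))))
              (extensions⇓ dₑ I (allowed S I) (enum I) (collect S enum its) (enum≤ I)
                (Short.↑⇓ Short.↑⇓ Short.↑⇓ G⇓₁)
                (Short.↑⇓ Short.tl⇓ (Short.hd⇓ (Short.var⇓ 0)))
                (Short.var⇓ 0)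
                (submatrix⇓ rows (allowed S I) (↑⇓ ↑⇓ ↑⇓ G⇓) (var⇓ 0) ⨾⇓ enumerator⇓ I)
                (var⇓ 2))) }

module Main {M W n : ℕ} (2≤M : 2 ≤ M) (1≤W : 1 ≤ W) (n≤M : n ≤ M) (rows : Matrix n) where

  open Run {M} {W} 2≤M 1≤W
  open LongLoops {M} {W} 2≤M 1≤W
  open SetRoutines {M} {W} 2≤M 1≤W n≤M
  open Enumeration rows
  open EnumerationRoutines {M} {W} 2≤M 1≤W n≤M rows

  main⇓ : ∀ c t recogniser enumerator (sparse : Subset n → Bool) →
    let open Search rows sparse
        dₘ = 2 * suc (2 * c)
        masks = items n (suc (2 * c))
        its = items n t
        S = pick its (improved masks n) masks in
    (enum : ∀ I → List (Subset ∣ allowed S I ∣)) →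
    (∀ X → code recogniser 0 ⊩ encodeRows (submatrix X X rows) ⇓ encodeBool (sparse X)) →
    (∀ I → List.length (enum I) ≤ W * M ^ 4) →
    (∀ I → code enumerator 0 ⊩ encodeRows (submatrix (allowed S I) (allowed S I) rows)
             ⇓ encodeList encodeSubset (enum I)) →
    2 ^ suc (2 * c) ≤ M ^ dₘ → 2 ^ t ≤ M ^ 2 →
    (∀ {j} → j ≤ n → List.length (items j (suc (2 * c))) ≤ M ^ dₘ) →
    (∀ {j} → j ≤ n → List.length (items j t) ≤ M ^ 2) →
    mainᶜ c recogniser enumerator t ⊩ encodeRows rows ⇓ encodeList encodeSubset (collect S enum its)
  main⇓ c t recogniser enumerator sparse enum recogniser⇓ enum≤ enumerator⇓ 2^m≤ 2^t≤ masks≤ items≤ =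
    (id⇓ ∙⇓ nil⇓) ⨾⇓
    let⇓ (items⇓ dₘ (suc (2 * c)) rows 2^m≤ (λ j<n → masks≤ (<⇒≤ j<n)) (var⇓ 0))
    (let⇓ (items⇓ 2 t rows 2^t≤ (λ j<n → items≤ (<⇒≤ j<n)) (var⇓ 1))
    (let⇓ (improved⇓ dₘ masks (masks≤ ≤-refl) (var⇓ 2) (var⇓ 1))
    (let⇓ (pick⇓ dₘ 2 (improved masks n) its masks (masks≤ ≤-refl) (items≤ ≤-refl)
             (var⇓ 3) (var⇓ 1) (var⇓ 0) (var⇓ 2))
    (collect⇓ 2 4 (code enumerator 0) (pick its (improved masks n) masks) enum its enum≤ enumerator⇓
      (items≤ ≤-refl) (Short.var⇓ 4) (var⇓ 4) (var⇓ 0) (var⇓ 2)))))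
    where
    open Search rows sparse
    open SearchRoutines {M} {W} 2≤M 1≤W n≤M (code recogniser 0) rows sparse recogniser⇓
    dₘ = 2 * suc (2 * c)
    masks = items n (suc (2 * c))
    its = items n t

-- Bit vectors as sets.

private variable
  n : ℕ

lookup-ext : ∀ {a} {T : Set a} {xs ys : Vec T n} → (∀ i → lookup xs i ≡ lookup ys i) → xs ≡ ys
lookup-ext {xs = xs} {ys} eq = begin
  xs                   ≡⟨ tabulate∘lookup xs ⟨
  tabulate (lookup xs) ≡⟨ tabulate-cong eq ⟩
  tabulate (lookup ys) ≡⟨ tabulate∘lookup ys ⟩
  ys                   ∎
  where open ≡-Reasoning

∈⇒true : ∀ {A : Subset n} {i} → i ∈ A → lookup A i ≡ true
∈⇒true = []=⇒lookup

true⇒∈ : ∀ {A : Subset n} {i} → lookup A i ≡ true → i ∈ A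
true⇒∈ {A = A} {i} = lookup⇒[]= i A

∉⇒false : ∀ {A : Subset n} {i} → i ∉ A → lookup A i ≡ false
∉⇒false i∉A = ¬-not (i∉A ∘ true⇒∈)

false⇒∉ : ∀ {A : Subset n} {i} → lookup A i ≡ false → i ∉ A
false⇒∉ eq i∈A = case trans (sym eq) (∈⇒true i∈A) of λ ()

x∈p∖q⁺ : ∀ {A B : Subset n} {i} → i ∈ A → i ∉ B → i ∈ A ∖ B
x∈p∖q⁺ {A = A} {B} {i} i∈A i∉B = true⇒∈ (trans (lookup-zipWith _ i A B)
  (cong₂ (λ x y → x ∧ not y) (∈⇒true i∈A) (∉⇒false i∉B)))

x∈p∖q⁻ : ∀ (A B : Subset n) {i} → i ∈ A ∖ B → i ∈ A × i ∉ B
x∈p∖q⁻ A B {i} i∈ with lookup A i in eqA | lookup B i in eqB | trans (sym (lookup-zipWith _ i A B)) (∈⇒true i∈)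
... | true  | false | _ = true⇒∈ eqA , false⇒∉ eqB
... | true  | true  | ()
... | false | _     | ()

⊕-involutive : ∀ (S A : Subset n) → S ⊕ (S ⊕ A) ≡ A
⊕-involutive []           []          = refl
⊕-involutive (false ∷ S) (x ∷ A)     = cong (x ∷_) (⊕-involutive S A)
⊕-involutive (true ∷ S)  (true ∷ A)  = cong (true ∷_) (⊕-involutive S A)
⊕-involutive (true ∷ S)  (false ∷ A) = cong (false ∷_) (⊕-involutive S A)

-- Subtraction-free form of |S ⊕ A| = |A ∖ S| + |S ∖ A|.
∣⊕∣-balance : ∀ (S A : Subset n) → ∣ S ⊕ A ∣ + ∣ S ∣ ≡ ∣ A ∣ + 2 * ∣ S ∖ A ∣
∣⊕∣-balance []          []          = refl
∣⊕∣-balance (false ∷ S) (false ∷ A) = ∣⊕∣-balance S A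
∣⊕∣-balance (false ∷ S) (true ∷ A)  = cong suc (∣⊕∣-balance S A)
∣⊕∣-balance (true ∷ S)  (true ∷ A)  =
  trans (+-suc ∣ S ⊕ A ∣ ∣ S ∣) (cong suc (∣⊕∣-balance S A))
∣⊕∣-balance (true ∷ S)  (false ∷ A) = begin
  suc ∣ S ⊕ A ∣ + suc ∣ S ∣          ≡⟨ regroup ∣ S ⊕ A ∣ ∣ S ∣ ⟩
  2 + (∣ S ⊕ A ∣ + ∣ S ∣)            ≡⟨ cong (2 +_) (∣⊕∣-balance S A) ⟩
  2 + (∣ A ∣ + 2 * ∣ S ∖ A ∣)        ≡⟨ regroup′ ∣ A ∣ ∣ S ∖ A ∣ ⟩
  ∣ A ∣ + 2 * suc ∣ S ∖ A ∣          ∎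
  where
  open ≡-Reasoning
  regroup : ∀ x y → suc x + suc y ≡ 2 + (x + y)
  regroup = solve-∀
  regroup′ : ∀ x y → 2 + (x + 2 * y) ≡ x + 2 * suc y
  regroup′ = solve-∀

intermediate-subset : ∀ (A B : Subset n) {m} → A ⊆ˢ B → ∣ A ∣ ≤ m → m ≤ ∣ B ∣ →
                      ∃ λ Y → A ⊆ˢ Y × Y ⊆ˢ B × ∣ Y ∣ ≡ m
intermediate-subset []      []           A⊆B _ z≤n = [] , (λ ()) , (λ ()) , refl
intermediate-subset (true ∷ A) (false ∷ B) A⊆B _ _ with () ← A⊆B Vec.here
intermediate-subset (false ∷ A) (false ∷ B) A⊆B A≤m m≤B
  with Y , A⊆Y , Y⊆B , eq ← intermediate-subset A B (drop-∷-⊆ A⊆B) A≤m m≤B =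
  false ∷ Y , s⊆s A⊆Y , s⊆s Y⊆B , eq
intermediate-subset (true ∷ A) (true ∷ B) A⊆B (s≤s A≤m) (s≤s m≤B)
  with Y , A⊆Y , Y⊆B , eq ← intermediate-subset A B (drop-∷-⊆ A⊆B) A≤m m≤B =
  true ∷ Y , s⊆s A⊆Y , s⊆s Y⊆B , cong suc eq
intermediate-subset (false ∷ A) (true ∷ B) {m} A⊆B A≤m m≤B with m ≤? ∣ B ∣
... | yes m≤ with Y , A⊆Y , Y⊆B , eq ← intermediate-subset A B (drop-∷-⊆ A⊆B) A≤m m≤ =
  false ∷ Y , s⊆s A⊆Y , out⊆ Y⊆B , eq
... | no m≰ = true ∷ B , A⊆B , ⊆-refl , ≤-antisym (≰⇒> m≰) m≤B

meets⁺ : ∀ {A B : Subset n} {i} → i ∈ A → i ∈ B → meets A B ≡ true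
meets⁺ Vec.here Vec.here = refl
meets⁺ {A = x ∷ _} {y ∷ _} (Vec.there i∈A) (Vec.there i∈B)
  rewrite meets⁺ i∈A i∈B with x ∧ y
... | true  = refl
... | false = refl

meets⁻ : ∀ (A B : Subset n) → meets A B ≡ true → ∃ λ i → i ∈ A × i ∈ B
meets⁻ []          []          ()
meets⁻ (true ∷ A)  (true ∷ B)  _ = zero , Vec.here , Vec.here
meets⁻ (true ∷ A)  (false ∷ B) eq with i , i∈A , i∈B ← meets⁻ A B eq = suc i , Vec.there i∈A , Vec.there i∈B
meets⁻ (false ∷ A) (_ ∷ B)     eq with i , i∈A , i∈B ← meets⁻ A B eq = suc i , Vec.there i∈A , Vec.there i∈B

disjoint⁺ : ∀ {A B : Subset n} → (∀ {i} → i ∈ A → i ∉ B) → meets A B ≡ false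
disjoint⁺ {A = A} {B} h = ¬-not λ eq → let i , i∈A , i∈B = meets⁻ A B eq in h i∈A i∈B

disjoint⁻ : ∀ {A B : Subset n} {i} → meets A B ≡ false → i ∈ A → i ∉ B
disjoint⁻ eq i∈A i∈B = case trans (sym eq) (meets⁺ i∈A i∈B) of λ ()

complementary⁺ : ∀ (A B : Subset n) → (∀ i → lookup A i ≡ not (lookup B i)) → complementary A B ≡ true
complementary⁺ []      []      h = refl
complementary⁺ (x ∷ A) (y ∷ B) h rewrite h zero | complementary⁺ A B (h ∘ suc) with y
... | true  = refl
... | false = refl

complementary⁻ : ∀ (A B : Subset n) → complementary A B ≡ true → ∀ i → lookup A i ≡ not (lookup B i)
complementary⁻ (true ∷ A)  (false ∷ B) eq zero    = refl
complementary⁻ (false ∷ A) (true ∷ B)  eq zero    = refl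
complementary⁻ (true ∷ A)  (false ∷ B) eq (suc i) = complementary⁻ A B eq i
complementary⁻ (false ∷ A) (true ∷ B)  eq (suc i) = complementary⁻ A B eq i

member-∈ : ∀ (X : Subset n) i → member X i ∈ X
member-∈ (true ∷ X)  zero    = Vec.here
member-∈ (true ∷ X)  (suc i) = Vec.there (member-∈ X i)
member-∈ (false ∷ X) i       = Vec.there (member-∈ X i)

member-injective : ∀ (X : Subset n) {i j} → member X i ≡ member X j → i ≡ j
member-injective (true ∷ X)  {zero}  {zero}  eq = refl
member-injective (true ∷ X)  {suc i} {suc j} eq = cong suc (member-injective X (suc-injective eq))
member-injective (false ∷ X)                 eq = member-injective X (suc-injective eq)

index : ∀ {X : Subset n} {i} → i ∈ X → ∃ λ j → member X j ≡ i
index                Vec.here        = zero , refl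
index {X = true ∷ _}  (Vec.there i∈X) = let j , eq = index i∈X in suc j , cong suc eq
index {X = false ∷ _} (Vec.there i∈X) = let j , eq = index i∈X in j , cong suc eq

lookup-compress : ∀ {a} {T : Set a} (X : Subset n) (xs : Vec T n) i →
                  lookup (compress X xs) i ≡ lookup xs (member X i)
lookup-compress (true ∷ X)  (x ∷ xs) zero    = refl
lookup-compress (true ∷ X)  (x ∷ xs) (suc i) = lookup-compress X xs i
lookup-compress (false ∷ X) (x ∷ xs) i       = lookup-compress X xs i

compress-tabulate : ∀ {a} {T : Set a} (X : Subset n) (f : Fin n → T) →
                    compress X (tabulate f) ≡ tabulate (f ∘ member X)
compress-tabulate []          f = refl
compress-tabulate (true ∷ X)  f = cong (f zero ∷_) (compress-tabulate X (f ∘ suc))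
compress-tabulate (false ∷ X) f = compress-tabulate X (f ∘ suc)

∣compress∣ : ∀ (X A : Subset n) → ∣ compress X A ∣ ≡ ∣ X ∩ A ∣
∣compress∣ []          []          = refl
∣compress∣ (true ∷ X)  (true ∷ A)  = cong suc (∣compress∣ X A)
∣compress∣ (true ∷ X)  (false ∷ A) = ∣compress∣ X A
∣compress∣ (false ∷ X) (_ ∷ A)     = ∣compress∣ X A

expand-compress : ∀ (X A : Subset n) → expand X (compress X A) ≡ X ∩ A
expand-compress []          []      = refl
expand-compress (true ∷ X)  (y ∷ A) = cong (y ∷_) (expand-compress X A)
expand-compress (false ∷ X) (y ∷ A) = cong (false ∷_) (expand-compress X A)

compress-expand : ∀ (X : Subset n) J → compress X (expand X J) ≡ J
compress-expand []          []      = refl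
compress-expand (true ∷ X)  (y ∷ J) = cong (y ∷_) (compress-expand X J)
compress-expand (false ∷ X) J       = compress-expand X J

expand-⊆ : ∀ (X : Subset n) J → expand X J ⊆ˢ X
expand-⊆ (true ∷ X)  (true ∷ J) Vec.here       = Vec.here
expand-⊆ (true ∷ X)  (y ∷ J)    (Vec.there i∈) = Vec.there (expand-⊆ X J i∈)
expand-⊆ (false ∷ X) J          (Vec.there i∈) = Vec.there (expand-⊆ X J i∈)

-- Small sets: completeness, uniqueness and number.

sets : List (Item n) → List (Subset n)
sets = List.map proj₂

∈-extend-outside : ∀ {its : List (Item n)} {b v} → (b , v) ∈ˡ its → (b , outside ∷ v) ∈ˡ extend its
∈-extend-outside {b = zero}  (here refl) = here refl
∈-extend-outside {b = suc b} (here refl) = here refl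
∈-extend-outside {its = (zero , _) ∷ _}  (there ∈its) = there (∈-extend-outside ∈its)
∈-extend-outside {its = (suc _ , _) ∷ _} (there ∈its) = there (there (∈-extend-outside ∈its))

∈-extend-inside : ∀ {its : List (Item n)} {b v} → (suc b , v) ∈ˡ its → (b , inside ∷ v) ∈ˡ extend its
∈-extend-inside (here refl) = there (here refl)
∈-extend-inside {its = (zero , _) ∷ _}  (there ∈its) = there (∈-extend-inside ∈its)
∈-extend-inside {its = (suc _ , _) ∷ _} (there ∈its) = there (there (∈-extend-inside ∈its))

∈-extend⁻ : ∀ (its : List (Item n)) {b x v} → (b , x ∷ v) ∈ˡ extend its →
            ∃ λ b′ → (b′ , v) ∈ˡ its × b′ + ∣ v ∣ ≡ b + ∣ x ∷ v ∣
∈-extend⁻ ((zero , v) ∷ its)  (here refl) = zero , here refl , refl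
∈-extend⁻ ((zero , v) ∷ its)  (there ∈its) =
  let b , ∈its , eq = ∈-extend⁻ its ∈its in b , there ∈its , eq
∈-extend⁻ ((suc b , v) ∷ its) (here refl) = suc b , here refl , refl
∈-extend⁻ ((suc b , v) ∷ its) (there (here refl)) = suc b , here refl , sym (+-suc b ∣ v ∣)
∈-extend⁻ ((suc b , v) ∷ its) (there (there ∈its)) =
  let b , ∈its , eq = ∈-extend⁻ its ∈its in b , there ∈its , eq

∈-items⁺ : ∀ {k} b (v : Subset n) → b + ∣ v ∣ ≡ k → (b , v) ∈ˡ items n k
∈-items⁺ b []          eq = here (cong (_, []) (trans (sym (+-identityʳ b)) eq))
∈-items⁺ b (true ∷ v)  eq = ∈-extend-inside (∈-items⁺ (suc b) v (trans (sym (+-suc b ∣ v ∣)) eq))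
∈-items⁺ b (false ∷ v) eq = ∈-extend-outside (∈-items⁺ b v eq)

∈-items⁻ : ∀ {k} b (v : Subset n) → (b , v) ∈ˡ items n k → b + ∣ v ∣ ≡ k
∈-items⁻ b []      (here refl) = +-identityʳ b
∈-items⁻ {n = suc n} {k} b (x ∷ v) ∈its =
  let b′ , ∈its′ , eq = ∈-extend⁻ (items n k) ∈its in trans (sym eq) (∈-items⁻ b′ v ∈its′)

small-set-item : ∀ {k} (v : Subset n) → ∣ v ∣ ≤ k → (k ∸ ∣ v ∣ , v) ∈ˡ items n k
small-set-item v ≤k = ∈-items⁺ _ v (m∸n+n≡m ≤k)

∈-sets-extend⁻ : ∀ (its : List (Item n)) {x v} → x ∷ v ∈ˡ sets (extend its) → v ∈ˡ sets its
∈-sets-extend⁻ its ∈sets with (_ , _) , ∈its , refl ← ∈-map⁻ proj₂ ∈sets =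
  let _ , ∈its′ , _ = ∈-extend⁻ its ∈its in ∈-map⁺ proj₂ ∈its′

fresh : ∀ {a} {T : Set a} {x : T} {xs} → x ∉ˡ xs → All (x ≢_) xs
fresh x∉ = All.tabulate λ { y∈ refl → x∉ y∈ }

unique-sets-extend : ∀ (its : List (Item n)) → Unique (sets its) → Unique (sets (extend its))
unique-sets-extend []                 []              = []
unique-sets-extend ((zero , v) ∷ its) (v≢ ∷ unique) =
  fresh (λ ∈sets → All.lookup v≢ (∈-sets-extend⁻ its ∈sets) refl) ∷ unique-sets-extend its unique
unique-sets-extend ((suc b , v) ∷ its) (v≢ ∷ unique) =
  ((λ ()) ∷ fresh (λ ∈sets → All.lookup v≢ (∈-sets-extend⁻ its ∈sets) refl)) ∷
  fresh (λ ∈sets → All.lookup v≢ (∈-sets-extend⁻ its ∈sets) refl) ∷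
  unique-sets-extend its unique

unique-sets-items : ∀ n k → Unique (sets (items n k))
unique-sets-items zero    k = [] ∷ []
unique-sets-items (suc n) k = unique-sets-extend (items n k) (unique-sets-items n k)

-- The number of items that an item with budget b gives rise to in m rounds of extension.
descendants : ℕ → ℕ → ℕ
descendants zero    b       = 1
descendants (suc m) zero    = descendants m zero
descendants (suc m) (suc b) = descendants m (suc b) + descendants m b

allDescendants : ℕ → List (Item n) → ℕ
allDescendants m []              = 0
allDescendants m ((b , _) ∷ its) = descendants m b + allDescendants m its

allDescendants-extend : ∀ m (its : List (Item n)) → allDescendants m (extend its) ≡ allDescendants (suc m) its
allDescendants-extend m []                  = refl
allDescendants-extend m ((zero , _) ∷ its)  = cong (descendants m zero +_) (allDescendants-extend m its)
allDescendants-extend m ((suc b , _) ∷ its) = trans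
  (cong (λ k → descendants m (suc b) + (descendants m b + k)) (allDescendants-extend m its))
  (sym (+-assoc (descendants m (suc b)) (descendants m b) _))

-- The induction trades a round of extension already performed for one still to come, so m has to be
-- general; m = 0 gives the length.
allDescendants-items : ∀ n m k → allDescendants m (items n k) ≡ descendants (n + m) k
allDescendants-items zero    m k = +-identityʳ (descendants m k)
allDescendants-items (suc n) m k = begin
  allDescendants m (extend (items n k))  ≡⟨ allDescendants-extend m (items n k) ⟩
  allDescendants (suc m) (items n k)     ≡⟨ allDescendants-items n (suc m) k ⟩
  descendants (n + suc m) k              ≡⟨ cong (λ j → descendants j k) (+-suc n m) ⟩
  descendants (suc n + m) k              ∎
  where open ≡-Reasoning

length≡allDescendants : ∀ (its : List (Item n)) → List.length its ≡ allDescendants 0 its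
length≡allDescendants []        = refl
length≡allDescendants (_ ∷ its) = cong suc (length≡allDescendants its)

-- The recursion is Pascal's rule: `descendants m b` is the sum of the binomial coefficients of m up
-- to b.
descendants≤ : ∀ m b → descendants m b ≤ suc m ^ b
descendants≤ zero    b       = ≤-reflexive (sym (^-zeroˡ b))
descendants≤ (suc m) zero    = descendants≤ m zero
descendants≤ (suc m) (suc b) = begin
  descendants m (suc b) + descendants m b  ≤⟨ +-mono-≤ (descendants≤ m (suc b)) (descendants≤ m b) ⟩
  suc m * suc m ^ b + suc m ^ b            ≡⟨ +-comm (suc m * suc m ^ b) (suc m ^ b) ⟩
  suc (suc m) * suc m ^ b                  ≤⟨ *-monoʳ-≤ (suc (suc m)) (^-monoˡ-≤ b (n≤1+n (suc m))) ⟩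
  suc (suc m) ^ suc b                      ∎
  where open ≤-Reasoning

length-items≤ : ∀ n k → List.length (items n k) ≤ suc n ^ k
length-items≤ n k = begin
  List.length (items n k)        ≡⟨ length≡allDescendants (items n k) ⟩
  allDescendants 0 (items n k)   ≡⟨ allDescendants-items n 0 k ⟩
  descendants (n + 0) k          ≡⟨ cong (λ m → descendants m k) (+-identityʳ n) ⟩
  descendants n k                ≤⟨ descendants≤ n k ⟩
  suc n ^ k                      ∎
  where open ≤-Reasoning

-- Adjacency matrices and induced subgraphs.

encodeList-tabulate : ∀ {a b} {A : Set a} {B : Set b} {encA : A → Tree} {encB : B → Tree} {n}
  (f : Fin n → A) (g : Fin n → B) → (∀ i → encA (f i) ≡ encB (g i)) →
  encodeList encA (List.tabulate f) ≡ encodeVec encB (tabulate g)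
encodeList-tabulate {n = zero}  f g eq = refl
encodeList-tabulate {n = suc n} f g eq = cong₂ _∙_ (eq zero) (encodeList-tabulate (f ∘ suc) (g ∘ suc) (eq ∘ suc))

adjacency : (G : Graph) → Matrix (order G)
adjacency G = tabulate λ u → tabulate (adj G u)

encodeGraph≡ : ∀ G → encodeGraph G ≡ encodeRows (adjacency G)
encodeGraph≡ G = encodeList-tabulate _ _ λ u → encodeList-tabulate (adj G u) (adj G u) λ _ → refl

submatrix-adjacency : ∀ G X → submatrix X X (adjacency G) ≡ adjacency (G [ X ])
submatrix-adjacency G X = begin
  Vec.map (compress X) (compress X (adjacency G))
    ≡⟨ cong (Vec.map (compress X)) (compress-tabulate X _) ⟩
  Vec.map (compress X) (tabulate λ i → tabulate (adj G (member X i)))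
    ≡⟨ tabulate-∘ (compress X) _ ⟨
  tabulate (λ i → compress X (tabulate (adj G (member X i))))
    ≡⟨ tabulate-cong (λ i → compress-tabulate X (adj G (member X i))) ⟩
  adjacency (G [ X ]) ∎
  where open ≡-Reasoning

[]-mono-≤ᵢ : ∀ G {X Y} → X ⊆ˢ Y → (G [ X ]) ≤ᵢ (G [ Y ])
[]-mono-≤ᵢ G {X} {Y} X⊆Y =
  f ,
  (λ {i} {j} eq → member-injective X
    (trans (sym (member-f i)) (trans (cong (member Y) eq) (member-f j)))) ,
  λ i j → sym (cong₂ (adj G) (member-f i) (member-f j))
  where
  f : Fin ∣ X ∣ → Fin ∣ Y ∣
  f i = proj₁ (index (X⊆Y (member-∈ X i)))
  member-f : ∀ i → member Y (f i) ≡ member X i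
  member-f i = proj₂ (index (X⊆Y (member-∈ X i)))

-- Neighbourhoods and the listing of maximal independent sets.

module _ (G : Graph) where

  open Enumeration (adjacency G)

  private
    N : VertexSet G → VertexSet G
    N = neighbours (adjacency G)

    variable
      A B S : VertexSet G
      u v : Fin (order G)

  lookup-N : ∀ A u → lookup (N A) u ≡ meets (tabulate (adj G u)) A
  lookup-N A u = trans (lookup-map u (λ row → meets row A) (adjacency G))
    (cong (λ row → meets row A) (lookup∘tabulate _ u))

  N⁺ : v ∈ A → adj G u v ≡ true → u ∈ N A
  N⁺ {v} {A} {u} v∈A eq =
    true⇒∈ (trans (lookup-N A u) (meets⁺ {A = tabulate (adj G u)} (true⇒∈ (trans (lookup∘tabulate (adj G u) v) eq)) v∈A))

  N⁻ : ∀ A → u ∈ N A → ∃ λ v → v ∈ A × adj G u v ≡ true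
  N⁻ {u} A u∈ = let v , adj-uv , v∈A = meets⁻ (tabulate (adj G u)) A (trans (sym (lookup-N A u)) (∈⇒true u∈)) in
    v , v∈A , trans (sym (lookup∘tabulate (adj G u) v)) (∈⇒true adj-uv)

  N-mono : A ⊆ˢ B → N A ⊆ˢ N B
  N-mono {A} A⊆B u∈ = let _ , v∈A , eq = N⁻ A u∈ in N⁺ (A⊆B v∈A) eq

  independent⁺ : (∀ {u} → u ∈ N A → u ∉ A) → Independent G A
  independent⁺ h u∈A v∈A = ¬-not λ eq → h (N⁺ v∈A eq) u∈A

  independent⁻ : Independent G A → u ∈ N A → u ∉ A
  independent⁻ {A} independent u∈N u∈A =
    let _ , v∈A , eq = N⁻ A u∈N in case trans (sym eq) (independent u∈A v∈A) of λ ()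

  independent-⊆ : A ⊆ˢ B → Independent G B → Independent G A
  independent-⊆ A⊆B independent u∈ v∈ = independent (A⊆B u∈) (A⊆B v∈)

  independent-insert : Independent G A → u ∉ N A → Independent G (A ∪ ⁅ u ⁆)
  independent-insert {A} {u} independent u∉N {x} {y} x∈ y∈ with x∈p∪q⁻ A ⁅ u ⁆ x∈ | x∈p∪q⁻ A ⁅ u ⁆ y∈
  ... | inj₁ x∈A | inj₁ y∈A = independent x∈A y∈A
  ... | inj₂ x∈u | inj₁ y∈A rewrite x∈⁅y⁆⇒x≡y u x∈u = ¬-not (u∉N ∘ N⁺ y∈A)
  ... | inj₁ x∈A | inj₂ y∈u rewrite x∈⁅y⁆⇒x≡y u y∈u = ¬-not (u∉N ∘ N⁺ x∈A ∘ trans (symm G u x))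
  ... | inj₂ x∈u | inj₂ y∈u rewrite x∈⁅y⁆⇒x≡y u x∈u | x∈⁅y⁆⇒x≡y u y∈u = irrefl G u

  maximal⁺ : MaximalIndependent G A → maximal A ≡ true
  maximal⁺ {A} (independent , unextendable) = complementary⁺ (N A) A λ u → lemma u (u ∈? A) (u ∈? N A)
    where
    lemma : ∀ u → _ → _ → lookup (N A) u ≡ not (lookup A u)
    lemma u (yes u∈A) _ = trans (∉⇒false λ u∈N → independent⁻ independent u∈N u∈A)
      (cong not (sym (∈⇒true u∈A)))
    lemma u (no u∉A) (yes u∈N) = trans (∈⇒true u∈N) (cong not (sym (∉⇒false u∉A)))
    lemma u (no u∉A) (no u∉N) = ⊥-elim (unextendable (A ∪ ⁅ u ⁆)
      (independent-insert independent u∉N)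
      (p⊆p∪q ⁅ u ⁆ , u , q⊆p∪q A ⁅ u ⁆ (x∈⁅x⁆ u) , u∉A))

  ∉⇒∈N : maximal A ≡ true → u ∉ A → u ∈ N A
  ∉⇒∈N {A} {u} eq u∉A = true⇒∈ (trans (complementary⁻ (N A) A eq u) (cong not (∉⇒false u∉A)))

  maximal⁻ : maximal A ≡ true → MaximalIndependent G A
  maximal⁻ {A} eq =
    independent⁺ (λ {u} u∈N u∈A → false⇒∉
      (trans (complementary⁻ (N A) A eq u) (cong not (∈⇒true u∈A))) u∈N) ,
    λ { B independent (A⊆B , u , u∈B , u∉A) →
        independent⁻ independent (N-mono A⊆B (∉⇒∈N eq u∉A)) u∈B }

  module _ (S : VertexSet G) (enum : ∀ I → List (Subset ∣ allowed S I ∣)) where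

    ∈-extensions⁺ : ∀ {I X J rest} Js → J ∈ˡ Js → maximal (I ∪ expand X J) ≡ true →
                    I ∪ expand X J ∈ˡ extensions I X Js rest
    ∈-extensions⁺ (_ ∷ Js) (here refl) max rewrite max = here refl
    ∈-extensions⁺ {I} {X} (J′ ∷ Js) (there J∈) max with maximal (I ∪ expand X J′)
    ... | true  = there (∈-extensions⁺ Js J∈ max)
    ... | false = ∈-extensions⁺ Js J∈ max

    rest⊆extensions : ∀ {I X rest} Js → A ∈ˡ rest → A ∈ˡ extensions I X Js rest
    rest⊆extensions [] A∈ = A∈
    rest⊆extensions {I = I} {X} (J ∷ Js) A∈ with maximal (I ∪ expand X J)
    ... | true  = there (rest⊆extensions {I = I} {X} Js A∈)
    ... | false = rest⊆extensions {I = I} {X} Js A∈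

    ∈-extensions⁻ : ∀ {I X rest} Js → A ∈ˡ extensions I X Js rest →
      (maximal A ≡ true × ∃ λ J → J ∈ˡ Js × A ≡ I ∪ expand X J) ⊎ A ∈ˡ rest
    ∈-extensions⁻ [] A∈ = inj₂ A∈
    ∈-extensions⁻ {I = I} {X} (J ∷ Js) A∈ with maximal (I ∪ expand X J) in eq
    ∈-extensions⁻ (J ∷ Js) (here refl) | true = inj₁ (eq , J , here refl , refl)
    ∈-extensions⁻ (J ∷ Js) (there A∈)  | true with ∈-extensions⁻ Js A∈
    ... | inj₁ (max , J′ , J′∈ , A≡) = inj₁ (max , J′ , there J′∈ , A≡)
    ... | inj₂ A∈rest               = inj₂ A∈rest
    ∈-extensions⁻ (J ∷ Js) A∈          | false with ∈-extensions⁻ Js A∈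
    ... | inj₁ (max , J′ , J′∈ , A≡) = inj₁ (max , J′ , there J′∈ , A≡)
    ... | inj₂ A∈rest               = inj₂ A∈rest

    ∈-collect⁺ : ∀ {b I J} its → (b , I) ∈ˡ its → meets I S ≡ false → J ∈ˡ enum I →
      maximal (I ∪ expand (allowed S I) J) ≡ true →
      I ∪ expand (allowed S I) J ∈ˡ collect S enum its
    ∈-collect⁺ (_ ∷ its) (here refl) disjoint J∈ max rewrite disjoint = ∈-extensions⁺ _ J∈ max
    ∈-collect⁺ ((_ , I′) ∷ its) (there I∈) disjoint J∈ max with meets I′ S
    ... | true  = ∈-collect⁺ its I∈ disjoint J∈ max
    ... | false = rest⊆extensions {I = I′} {allowed S I′} (enum I′) (∈-collect⁺ its I∈ disjoint J∈ max)

    ∈-collect⁻ : ∀ its → A ∈ˡ collect S enum its →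
      maximal A ≡ true × ∃ λ I → I ∈ˡ sets its × meets I S ≡ false ×
        ∃ λ J → J ∈ˡ enum I × A ≡ I ∪ expand (allowed S I) J
    ∈-collect⁻ ((_ , I) ∷ its) A∈ with meets I S in disjoint
    ... | true  = let max , I′ , I′∈ , etc = ∈-collect⁻ its A∈ in max , I′ , there I′∈ , etc
    ... | false with ∈-extensions⁻ (enum I) A∈
    ...   | inj₁ (max , etc) = max , I , here refl , disjoint , etc
    ...   | inj₂ A∈rest      =
      let max , I′ , I′∈ , etc = ∈-collect⁻ its A∈rest in max , I′ , there I′∈ , etc

    allowed⊆ : ∀ I → allowed S I ⊆ˢ S
    allowed⊆ I u∈ = proj₁ (x∈p∖q⁻ S (N I) u∈)

    -- The trace outside S of a listed set recovers I, and its trace on allowed S I recovers J.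
    trace : ∀ {I J} → meets I S ≡ false → (I ∪ expand (allowed S I) J) ∖ S ≡ I
    trace {I} {J} disjoint = ⊆-antisym
      (λ u∈ → let u∈∪ , u∉S = x∈p∖q⁻ (I ∪ E) S u∈ in
        [ (λ u∈I → u∈I) , (λ u∈E → ⊥-elim (u∉S (allowed⊆ I (expand-⊆ _ J u∈E)))) ]′ (x∈p∪q⁻ I E u∈∪))
      λ u∈I → x∈p∖q⁺ (p⊆p∪q E u∈I) (disjoint⁻ {A = I} disjoint u∈I)
      where E = expand (allowed S I) J

    trace-allowed : ∀ {I J} → meets I S ≡ false → compress (allowed S I) (I ∪ expand (allowed S I) J) ≡ J
    trace-allowed {I} {J} disjoint = lookup-ext λ i → begin
      lookup (compress X (I ∪ E)) i                  ≡⟨ lookup-compress X (I ∪ E) i ⟩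
      lookup (I ∪ E) (member X i)                    ≡⟨ lookup-zipWith _∨_ (member X i) I E ⟩
      lookup I (member X i) ∨ lookup E (member X i)  ≡⟨ cong (_∨ lookup E (member X i)) (∉⇒false
        λ u∈I → disjoint⁻ {A = I} disjoint u∈I (allowed⊆ I (member-∈ X i))) ⟩
      lookup E (member X i)                          ≡⟨ lookup-compress X E i ⟨
      lookup (compress X E) i                        ≡⟨ cong (λ K → lookup K i) (compress-expand X J) ⟩
      lookup J i                                     ∎
      where
      open ≡-Reasoning
      X = allowed S I
      E = expand X J

    -- Two unions with the same I differ in their traces on `allowed S I`; those in `rest` differ in
    -- their traces outside S, which is the hypothesis on `rest`.
    unique-extensions : ∀ {I rest} Js → meets I S ≡ false → Unique Js → Unique rest →
      (∀ {A} → A ∈ˡ rest → A ∖ S ≢ I) → Unique (extensions I (allowed S I) Js rest)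
    unique-extensions []       disjoint unique unique-rest other = unique-rest
    unique-extensions {I} (J ∷ Js) disjoint (J≢ ∷ unique) unique-rest other
      with maximal (I ∪ expand (allowed S I) J)
    ... | false = unique-extensions Js disjoint unique unique-rest other
    ... | true  = fresh (λ ∈ext → [ (λ { (_ , J′ , J′∈ , eq) → All.lookup J≢ J′∈ (begin
                      J                                                 ≡⟨ trace-allowed disjoint ⟨
                      compress (allowed S I) (I ∪ expand (allowed S I) J)   ≡⟨ cong (compress (allowed S I)) eq ⟩
                      compress (allowed S I) (I ∪ expand (allowed S I) J′)  ≡⟨ trace-allowed disjoint ⟩
                      J′                                                ∎) })
                  , (λ ∈rest → other ∈rest (trace disjoint)) ]′ (∈-extensions⁻ Js ∈ext))
                ∷ unique-extensions Js disjoint unique unique-rest other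
      where open ≡-Reasoning

    unique-collect : ∀ its → Unique (sets its) → (∀ I → Unique (enum I)) → Unique (collect S enum its)
    unique-collect []              _               _           = []
    unique-collect ((_ , I) ∷ its) (I≢ ∷ unique) unique-enum with meets I S in disjoint
    ... | true  = unique-collect its unique unique-enum
    ... | false = unique-extensions (enum I) disjoint (unique-enum I) (unique-collect its unique unique-enum)
      λ A∈ eq → let _ , I′ , I′∈ , disjoint′ , J , _ , A≡ = ∈-collect⁻ its A∈ in
        All.lookup I≢ I′∈ (trans (sym eq) (trans (cong (_∖ S) A≡) (trace disjoint′)))

    module _ (enum-lists : ∀ I → ListsMaximalIndependentSets (G [ allowed S I ]) (enum I)) where

      -- Independence makes every vertex of A in S nonadjacent to the rest of A, hence allowed, so
      -- nothing of A is lost.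
      decompose : MaximalIndependent G A → (A ∖ S) ∪ expand (allowed S (A ∖ S)) (compress (allowed S (A ∖ S)) A) ≡ A
      decompose {A} (independent , _) = trans (cong (I ∪_) (expand-compress X A)) (⊆-antisym
        (λ u∈ → [ (λ u∈I → proj₁ (x∈p∖q⁻ A S u∈I)) , (λ u∈ → proj₂ (x∈p∩q⁻ X A u∈)) ]′ (x∈p∪q⁻ I (X ∩ A) u∈))
        λ {u} u∈A → x∈p∪q⁺ (case u ∈? S of λ
          { (yes u∈S) → inj₂ (x∈p∩q⁺ (x∈p∖q⁺ u∈S (λ u∈N →
              independent⁻ independent (N-mono (λ v∈ → proj₁ (x∈p∖q⁻ A S v∈)) u∈N) u∈A) , u∈A))
          ; (no u∉S) → inj₁ (x∈p∖q⁺ u∈A u∉S) }))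
        where
        I = A ∖ S
        X = allowed S I

      -- A neighbour in A of a vertex allowed by A ∖ S cannot lie in A ∖ S, hence is itself allowed.
      maximal-trace : MaximalIndependent G A →
                      MaximalIndependent (G [ allowed S (A ∖ S) ]) (compress (allowed S (A ∖ S)) A)
      maximal-trace {A} mis@(independent , _) =
        (λ {i} {j} i∈ j∈ → independent (∈A i∈) (∈A j∈)) ,
        λ { B independent-B (J⊆B , i , i∈B , i∉J) →
          let i∉A = λ i∈A → i∉J (true⇒∈ (trans (lookup-compress X A i) (∈⇒true i∈A)))
              v , v∈A , adj-iv = N⁻ A (∉⇒∈N (maximal⁺ mis) i∉A)
          in case v ∈? S of λ
            { (no v∉S) → proj₂ (x∈p∖q⁻ S (N I) (member-∈ X i)) (N⁺ (x∈p∖q⁺ v∈A v∉S) adj-iv)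
            ; (yes v∈S) →
              let j , eq = index (x∈p∖q⁺ v∈S (λ v∈N →
                             independent⁻ independent (N-mono (λ w∈ → proj₁ (x∈p∖q⁻ A S w∈)) v∈N) v∈A))
                  j∈J = true⇒∈ (trans (lookup-compress X A j) (trans (cong (lookup A) eq) (∈⇒true v∈A)))
              in case trans (sym (trans (cong (adj G (member X i)) eq) adj-iv)) (independent-B i∈B (J⊆B j∈J)) of λ ()
            } }
        where
        I = A ∖ S
        X = allowed S I
        ∈A : ∀ {i} → i ∈ compress X A → member X i ∈ A
        ∈A {i} i∈ = true⇒∈ (trans (sym (lookup-compress X A i)) (∈⇒true i∈))

      collect-lists : ∀ t → (∀ A → Independent G A → meets A S ≡ false → ∣ A ∣ ≤ t) →
                      ListsMaximalIndependentSets G (collect S enum (items (order G) t))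
      collect-lists t small =
        unique-collect its (unique-sets-items (order G) t) (λ I → proj₁ (enum-lists I)) ,
        λ A → mk⇔ (λ A∈ → maximal⁻ (proj₁ (∈-collect⁻ its A∈))) λ mis →
          let I = A ∖ S
              disjoint = disjoint⁺ λ u∈I → proj₂ (x∈p∖q⁻ A S u∈I)
              eq = decompose mis
          in subst (_∈ˡ collect S enum its) eq
               (∈-collect⁺ its
                 (small-set-item I (small I (independent-⊆ (λ u∈ → proj₁ (x∈p∖q⁻ A S u∈)) (proj₁ mis)) disjoint))
                 disjoint
                 (Equivalence.from (proj₂ (enum-lists I) _) (maximal-trace mis))
                 (trans (cong maximal eq) (maximal⁺ mis)))
        where its = items (order G) t

-- Local search for a sparse set near the unknown S₀.

module LocalSearch {n : ℕ} (rows : Matrix n) (sparse : Subset n → Bool) where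

  open Enumeration rows
  open Search rows sparse

  best-≥ : ∀ S its → ∣ S ∣ ≤ ∣ best S its ∣
  best-≥ S [] = ≤-refl
  best-≥ S ((_ , v) ∷ its) with ∣ best S its ∣ <ᵇ ∣ S ⊕ v ∣ in eq | sparse (S ⊕ v)
  ... | true  | true  = ≤-trans (best-≥ S its) (<⇒≤ (<ᵇ⇒< _ _ (subst T (sym eq) _)))
  ... | true  | false = best-≥ S its
  ... | false | _     = best-≥ S its

  best-sparse : ∀ S its → sparse S ≡ true → sparse (best S its) ≡ true
  best-sparse S []              S-sparse = S-sparse
  best-sparse S ((_ , v) ∷ its) S-sparse with ∣ best S its ∣ <ᵇ ∣ S ⊕ v ∣ | sparse (S ⊕ v) in eq
  ... | true  | true  = eq
  ... | true  | false = best-sparse S its S-sparse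
  ... | false | _     = best-sparse S its S-sparse

  best-optimal : ∀ S its {b v} → (b , v) ∈ˡ its → sparse (S ⊕ v) ≡ true → ∣ S ⊕ v ∣ ≤ ∣ best S its ∣
  best-optimal S ((_ , v) ∷ its) (here refl) v-sparse with ∣ best S its ∣ <ᵇ ∣ S ⊕ v ∣ in eq
  ... | true rewrite v-sparse = ≤-refl
  ... | false = ≮⇒≥ λ < → subst T eq (<⇒<ᵇ <)
  best-optimal S ((_ , w) ∷ its) (there v∈) v-sparse with ∣ best S its ∣ <ᵇ ∣ S ⊕ w ∣ in eq | sparse (S ⊕ w)
  ... | true  | true  = ≤-trans (best-optimal S its v∈ v-sparse) (<⇒≤ (<ᵇ⇒< _ _ (subst T (sym eq) _)))
  ... | true  | false = best-optimal S its v∈ v-sparse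
  ... | false | _     = best-optimal S its v∈ v-sparse

  pick-good : ∀ its S masks {b v} → (b , v) ∈ˡ masks →
    sparse (S ⊕ v) ≡ true → all (harmless (S ⊕ v)) its ≡ true →
    sparse (pick its S masks) ≡ true × all (harmless (pick its S masks)) its ≡ true
  pick-good its S ((_ , v) ∷ masks) (here refl) v-sparse v-harmless rewrite v-sparse | v-harmless =
    v-sparse , v-harmless
  pick-good its S ((_ , w) ∷ masks) (there v∈) v-sparse v-harmless
    with sparse (S ⊕ w) in w-sparse | all (harmless (S ⊕ w)) its in w-harmless
  ... | true  | true  = w-sparse , w-harmless
  ... | true  | false = pick-good its S masks v∈ v-sparse v-harmless
  ... | false | _     = pick-good its S masks v∈ v-sparse v-harmless

  module _ (c : ℕ) (S₀ : Subset n)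
    (sparse-outside : ∀ X → sparse X ≡ true → ∣ X ∖ S₀ ∣ ≤ c)
    (subsets-sparse : ∀ {X} → X ⊆ˢ S₀ → sparse X ≡ true) where

    -- What S loses lies outside S₀, hence at most c vertices, each counted twice by `∣⊕∣-balance`;
    -- the extra 1 is the vertex that Y may gain.
    distance : ∀ {S Y} → sparse S ≡ true → S ∩ S₀ ⊆ˢ Y → ∣ Y ∣ ≤ suc ∣ S ∣ → ∣ S ⊕ Y ∣ ≤ suc (2 * c)
    distance {S} {Y} S-sparse S∩S₀⊆Y Y≤ = +-cancelʳ-≤ ∣ S ∣ _ _ (begin
      ∣ S ⊕ Y ∣ + ∣ S ∣         ≡⟨ ∣⊕∣-balance S Y ⟩
      ∣ Y ∣ + 2 * ∣ S ∖ Y ∣     ≤⟨ +-mono-≤ Y≤ (*-monoʳ-≤ 2 (≤-trans (p⊆q⇒∣p∣≤∣q∣ S∖Y⊆S∖S₀) (sparse-outside S S-sparse))) ⟩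
      suc ∣ S ∣ + 2 * c         ≡⟨ cong suc (+-comm ∣ S ∣ (2 * c)) ⟩
      suc (2 * c) + ∣ S ∣       ∎)
      where
      open ≤-Reasoning
      S∖Y⊆S∖S₀ : S ∖ Y ⊆ˢ S ∖ S₀
      S∖Y⊆S∖S₀ x∈ = let x∈S , x∉Y = x∈p∖q⁻ S Y x∈ in
        x∈p∖q⁺ x∈S λ x∈S₀ → x∉Y (S∩S₀⊆Y (x∈p∩q⁺ (x∈S , x∈S₀)))

    masks = items n (suc (2 * c))

    -- If |S| < |S₀|, then S can be exchanged for |S| + 1 elements of S₀ that include S ∩ S₀.
    best-grows : ∀ {S} → sparse S ≡ true → ∣ S ∣ < ∣ S₀ ∣ → ∣ S ∣ < ∣ best S masks ∣
    best-grows {S} S-sparse S<S₀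
      with Y , S∩S₀⊆Y , Y⊆S₀ , ∣Y∣≡ ← intermediate-subset (S ∩ S₀) S₀ {suc ∣ S ∣}
             (p∩q⊆q S S₀) (≤-trans (∣p∩q∣≤∣p∣ S S₀) (n≤1+n _)) S<S₀ = begin
      suc ∣ S ∣          ≡⟨ ∣Y∣≡ ⟨
      ∣ Y ∣              ≡⟨ cong ∣_∣ (⊕-involutive S Y) ⟨
      ∣ S ⊕ (S ⊕ Y) ∣    ≤⟨ best-optimal S masks
                             (small-set-item (S ⊕ Y) (distance S-sparse S∩S₀⊆Y (≤-reflexive ∣Y∣≡)))
                             (trans (cong sparse (⊕-involutive S Y)) (subsets-sparse Y⊆S₀)) ⟩
      ∣ best S masks ∣   ∎
      where open ≤-Reasoning

    improved-sparse : ∀ j → sparse (improved masks j) ≡ true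
    improved-sparse zero    = subsets-sparse ⊥⊆
    improved-sparse (suc j) = best-sparse (improved masks j) masks (improved-sparse j)

    -- Sizes never decrease and grow strictly below |S₀|. At j = n both alternatives give |S₀| ≤
    -- |S|, without |S₀| being known.
    improved-large : ∀ j → j ≤ ∣ improved masks j ∣ ⊎ ∣ S₀ ∣ ≤ ∣ improved masks j ∣
    improved-large zero = inj₁ z≤n
    improved-large (suc j) with ∣ S₀ ∣ ≤? ∣ improved masks j ∣ | improved-large j
    ... | yes S₀≤ | _       = inj₂ (≤-trans S₀≤ (best-≥ (improved masks j) masks))
    ... | no S₀≰ | inj₁ j≤  = inj₁ (≤-trans (s≤s j≤) (best-grows (improved-sparse j) (≰⇒> S₀≰)))
    ... | no S₀≰ | inj₂ S₀≤ = ⊥-elim (S₀≰ S₀≤)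

    -- The mask `S ⊕ S₀` leads to S₀ itself, so the search succeeds. The set returned may be another
    -- one, but it has passed the same two tests.
    pick-improved-good : ∀ its → all (harmless S₀) its ≡ true →
      let S = pick its (improved masks n) masks in
      sparse S ≡ true × all (harmless S) its ≡ true
    pick-improved-good its S₀-harmless = pick-good its S masks
      (small-set-item (S ⊕ S₀) (distance (improved-sparse n) (p∩q⊆q S S₀)
        (≤-trans S₀≤S (n≤1+n _))))
      (trans (cong sparse (⊕-involutive S S₀)) (subsets-sparse ⊆-refl))
      (trans (cong (λ C → all (harmless C) its) (⊕-involutive S S₀)) S₀-harmless)
      where
      S = improved masks n
      S₀≤S : ∣ S₀ ∣ ≤ ∣ S ∣
      S₀≤S = [ ≤-trans (∣p∣≤n S₀) , (λ S₀≤ → S₀≤) ]′ (improved-large n)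

-- Independent sets that avoid the sparse set.

all⁺ : ∀ {a} {A : Set a} (p : A → Bool) xs → (∀ {x} → x ∈ˡ xs → p x ≡ true) → all p xs ≡ true
all⁺ p []       h = refl
all⁺ p (x ∷ xs) h rewrite h (here refl) = all⁺ p xs (h ∘ there)

all⁻ : ∀ {a} {A : Set a} (p : A → Bool) xs {x} → all p xs ≡ true → x ∈ˡ xs → p x ≡ true
all⁻ p (y ∷ xs) eq x∈ with p y in py
all⁻ p (y ∷ xs) eq (here refl) | true = py
all⁻ p (y ∷ xs) eq (there x∈)  | true = all⁻ p xs eq x∈

module _ (G : Graph) (t : ℕ) where

  open Enumeration (adjacency G)

  harmless⁺ : ∀ {S} → (∀ A → Independent G A → meets A S ≡ false → ∣ A ∣ ≢ t) →
              all (harmless S) (items (order G) t) ≡ true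
  harmless⁺ {S} none = all⁺ (harmless S) (items (order G) t) lemma
    where
    lemma : ∀ {item} → item ∈ˡ items (order G) t → harmless S item ≡ true
    lemma {suc b , v} _ = refl
    lemma {zero , v} v∈ with meets v S in disjoint | meets (neighbours (adjacency G) v) v in independent
    ... | true  | _     = refl
    ... | false | true  = refl
    ... | false | false = ⊥-elim (none v
      (independent⁺ G (disjoint⁻ {A = neighbours (adjacency G) v} independent)) disjoint
      (∈-items⁻ zero v v∈))

  -- A larger independent set would contain one of exactly t vertices, which the test has ruled out.
  -- The bound t matches `items`, which holds all sets up to this size.
  harmless⁻ : ∀ {S} → all (harmless S) (items (order G) t) ≡ true →
              ∀ A → Independent G A → meets A S ≡ false → ∣ A ∣ ≤ t
  harmless⁻ {S} S-harmless A independent disjoint = ≮⇒≥ λ t<∣A∣ →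
    let Y , _ , Y⊆A , ∣Y∣≡t = intermediate-subset ⊥ A {t} ⊥⊆
          (≤-trans (≤-reflexive (∣⊥∣≡0 (order G))) z≤n) (<⇒≤ t<∣A∣)
        meets-Y : meets Y S ∨ meets (neighbours (adjacency G) Y) Y ≡ true
        meets-Y = all⁻ (harmless S) (items (order G) t) S-harmless (∈-items⁺ zero Y ∣Y∣≡t)
        Y-disjoint : meets Y S ≡ false
        Y-disjoint = disjoint⁺ λ u∈Y → disjoint⁻ {A = A} disjoint (Y⊆A u∈Y)
        Y-independent : meets (neighbours (adjacency G) Y) Y ≡ false
        Y-independent = disjoint⁺ (independent⁻ G (independent-⊆ G Y⊆A independent))
    in case trans (sym meets-Y) (cong₂ _∨_ Y-disjoint Y-independent) of λ ()

-- Lengths of computed lists.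

depth : Tree → ℕ
depth nil     = 0
depth (x ∙ y) = suc (depth x ⊔ depth y)

-- Trees may grow exponentially because of sharing, but not their depths.
depth-run : ∀ {p x y k} → p ⊢ x ⇓ y [ k ] → depth y ≤ depth x + k
depth-run ⇓-id       = m≤m+n _ 1
depth-run ⇓-nil      = z≤n
depth-run ⇓-head-nil = z≤n
depth-run (⇓-head-∙ {x} {y}) = ≤-trans (m≤m⊔n (depth x) (depth y)) (≤-trans (n≤1+n _) (m≤m+n _ 1))
depth-run ⇓-tail-nil = z≤n
depth-run (⇓-tail-∙ {x} {y}) = ≤-trans (m≤n⊔m (depth x) (depth y)) (≤-trans (n≤1+n _) (m≤m+n _ 1))
depth-run (⇓-pair {x = x} {k = k} {l} run₁ run₂) = ≤-trans
  (s≤s (⊔-lub (≤-trans (depth-run run₁) (+-monoʳ-≤ (depth x) (m≤m+n k l)))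
              (≤-trans (depth-run run₂) (+-monoʳ-≤ (depth x) (m≤n+m l k)))))
  (≤-reflexive (sym (+-suc (depth x) (k + l))))
depth-run (⇓-⨾ {x = x} {k = k} {l} run₁ run₂) = begin
  _                      ≤⟨ depth-run run₂ ⟩
  _ + l                  ≤⟨ +-monoˡ-≤ l (depth-run run₁) ⟩
  depth x + k + l        ≡⟨ +-assoc (depth x) k l ⟩
  depth x + (k + l)      ≤⟨ +-monoʳ-≤ (depth x) (n≤1+n (k + l)) ⟩
  depth x + suc (k + l)  ∎
  where open ≤-Reasoning
depth-run (⇓-if-true {x = x} {k = k} {l} _ run) =
  ≤-trans (depth-run run) (+-monoʳ-≤ (depth x) (≤-trans (m≤n+m l k) (n≤1+n _)))
depth-run (⇓-if-false {x = x} {k = k} {l} _ run) =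
  ≤-trans (depth-run run) (+-monoʳ-≤ (depth x) (≤-trans (m≤n+m l k) (n≤1+n _)))
depth-run (⇓-while-stop {x = x} _) = m≤m+n (depth x) _
depth-run (⇓-while-step {x = x} {k = k} {l} {m} _ run₁ run₂) = begin
  _                            ≤⟨ depth-run run₂ ⟩
  _ + m                        ≤⟨ +-monoˡ-≤ m (depth-run run₁) ⟩
  depth x + l + m              ≤⟨ +-monoˡ-≤ m (+-monoʳ-≤ (depth x) (m≤n+m l k)) ⟩
  depth x + (k + l) + m        ≡⟨ +-assoc (depth x) (k + l) m ⟩
  depth x + (k + l + m)        ≤⟨ +-monoʳ-≤ (depth x) (n≤1+n _) ⟩
  depth x + suc (k + l + m)    ∎
  where open ≤-Reasoning

-- This yields `1≤W`: the recogniser halts on every graph and spends at least one step.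
time-positive : ∀ {p x y k} → p ⊢ x ⇓ y [ k ] → 1 ≤ k
time-positive ⇓-id               = s≤s z≤n
time-positive ⇓-nil              = s≤s z≤n
time-positive ⇓-head-nil         = s≤s z≤n
time-positive ⇓-head-∙           = s≤s z≤n
time-positive ⇓-tail-nil         = s≤s z≤n
time-positive ⇓-tail-∙           = s≤s z≤n
time-positive (⇓-pair _ _)       = s≤s z≤n
time-positive (⇓-⨾ _ _)          = s≤s z≤n
time-positive (⇓-if-true _ _)    = s≤s z≤n
time-positive (⇓-if-false _ _)   = s≤s z≤n
time-positive (⇓-while-stop _)   = s≤s z≤n
time-positive (⇓-while-step _ _ _) = s≤s z≤n

length≤depth : ∀ {a} {A : Set a} (enc : A → Tree) xs → List.length xs ≤ depth (encodeList enc xs)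
length≤depth enc []       = z≤n
length≤depth enc (x ∷ xs) = s≤s (≤-trans (length≤depth enc xs) (m≤n⊔m (depth (enc x)) _))

depth-encodeVec : ∀ {a n} {A : Set a} {enc : A → Tree} {d} → (∀ x → depth (enc x) ≤ d) →
                  (xs : Vec A n) → depth (encodeVec enc xs) ≤ n + d
depth-encodeVec enc≤ []       = z≤n
depth-encodeVec {n = suc n} {d = d} enc≤ (x ∷ xs) =
  s≤s (⊔-lub (≤-trans (enc≤ x) (m≤n+m d n)) (depth-encodeVec enc≤ xs))

depth-encodeBool : ∀ b → depth (encodeBool b) ≤ 1
depth-encodeBool true  = s≤s z≤n
depth-encodeBool false = z≤n

depth-encodeGraph : ∀ G → depth (encodeGraph G) ≤ order G + (order G + 1)
depth-encodeGraph G rewrite encodeGraph≡ G = depth-encodeVec (depth-encodeVec depth-encodeBool) (adjacency G)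

does-true : ∀ {p} {P : Set p} (P? : Dec P) → does P? ≡ true → P
does-true (yes p) _ = p

-- Arithmetic of M and W.

module Bounds (n t : ℕ) where

  -- The maximum only matters for n < 2, where 2 ≤ M would fail.
  M : ℕ
  M = (n ⊔ 2) ^ suc t

  private
    b = n ⊔ 2
    2≤b : 2 ≤ b
    2≤b = m≤n⊔m n 2
    instance
      _ = >-nonZero (≤-trans (s≤s z≤n) 2≤b)

  b≤M : b ≤ M
  b≤M = m≤m*n b (b ^ t) ⦃ m^n≢0 b t ⦄

  2≤M : 2 ≤ M
  2≤M = ≤-trans 2≤b b≤M

  n≤M : n ≤ M
  n≤M = ≤-trans (m≤m⊔n n 2) b≤M

  private
    instance
      _ = >-nonZero (≤-trans (s≤s z≤n) 2≤M)

    suc-n≤b² : suc n ≤ b ^ 2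
    suc-n≤b² = begin
      1 + n        ≤⟨ +-mono-≤ (≤-trans (s≤s z≤n) 2≤b) (m≤m⊔n n 2) ⟩
      b + b        ≡⟨ cong (b +_) (+-identityʳ b) ⟨
      2 * b        ≤⟨ *-monoˡ-≤ b 2≤b ⟩
      b * b        ≡⟨ cong (b *_) (*-identityʳ b) ⟨
      b ^ 2        ∎
      where open ≤-Reasoning

  2^t≤ : 2 ^ suc t ≤ M ^ 2
  2^t≤ = begin
    2 ^ suc t      ≤⟨ ^-monoˡ-≤ (suc t) 2≤b ⟩
    M              ≡⟨ *-identityʳ M ⟨
    M ^ 1          ≤⟨ ^-monoʳ-≤ M {1} {2} (s≤s z≤n) ⟩
    M ^ 2          ∎
    where open ≤-Reasoning

  2^k≤ : ∀ k → 2 ^ k ≤ M ^ (2 * k)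
  2^k≤ k = ≤-trans (^-monoˡ-≤ k 2≤M) (^-monoʳ-≤ M (m≤m+n k (k + 0)))

  -- Since n + 1 ≤ b ^ 2 and M already carries the exponent `suc t`, interchanging exponents leaves
  -- the power 2 for every t.
  items-t≤ : ∀ {j} → j ≤ n → List.length (items j (suc t)) ≤ M ^ 2
  items-t≤ {j} j≤n = begin
    List.length (items j (suc t))  ≤⟨ length-items≤ j (suc t) ⟩
    suc j ^ suc t                  ≤⟨ ^-monoˡ-≤ (suc t) (≤-trans (s≤s j≤n) suc-n≤b²) ⟩
    (b ^ 2) ^ suc t                ≡⟨ ^-*-assoc b 2 (suc t) ⟩
    b ^ (2 * suc t)                ≡⟨ cong (b ^_) (*-comm 2 (suc t)) ⟩
    b ^ (suc t * 2)                ≡⟨ ^-*-assoc b (suc t) 2 ⟨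
    M ^ 2                          ∎
    where open ≤-Reasoning

  items-k≤ : ∀ k {j} → j ≤ n → List.length (items j k) ≤ M ^ (2 * k)
  items-k≤ k {j} j≤n = begin
    List.length (items j k)  ≤⟨ length-items≤ j k ⟩
    suc j ^ k                ≤⟨ ^-monoˡ-≤ k (≤-trans (s≤s j≤n) (≤-trans suc-n≤b² (^-monoˡ-≤ 2 b≤M))) ⟩
    (M ^ 2) ^ k              ≡⟨ ^-*-assoc M 2 k ⟩
    M ^ (2 * k)              ∎
    where open ≤-Reasoning

  -- On the left stand the depth of an encoded graph on m vertices and a running time T, which
  -- together bound the length of a computed list. Each of the four summands is at most `W * M`.
  output≤ : ∀ {m T W} → m ≤ n → T ≤ W → 1 ≤ W → (m + (m + 1)) + T ≤ W * M ^ 4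
  output≤ {m} {T} {W} m≤n T≤W 1≤W = begin
    (m + (m + 1)) + T              ≤⟨ +-mono-≤ (+-mono-≤ m≤ (+-mono-≤ m≤ 1≤)) T≤ ⟩
    (P + (P + P)) + P              ≡⟨ regroup P ⟩
    2 * 2 * P                      ≤⟨ *-monoˡ-≤ P (*-mono-≤ 2≤M 2≤M) ⟩
    M * M * (W * M)                ≡⟨ regroup′ W M ⟩
    W * (M * (M * (M * 1)))        ≤⟨ *-monoʳ-≤ W (^-monoʳ-≤ M {3} {4} (n≤1+n 3)) ⟩
    W * M ^ 4                      ∎
    where
    open ≤-Reasoning
    instance _ = >-nonZero 1≤W
    P = W * M
    m≤ : m ≤ P
    m≤ = ≤-trans (≤-trans m≤n n≤M) (m≤n*m M W)
    1≤ : 1 ≤ P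
    1≤ = *-mono-≤ 1≤W (≤-trans (s≤s z≤n) 2≤M)
    T≤ : T ≤ P
    T≤ = ≤-trans T≤W (m≤m*n W M)
    regroup : ∀ p → (p + (p + p)) + p ≡ 2 * 2 * p
    regroup = solve-∀
    regroup′ : ∀ w m → m * m * (w * m) ≡ w * (m * (m * (m * 1)))
    regroup′ = solve-∀

-- Assembly for fixed classes and positive t.

module Enumerator {ℓ₁ ℓ₂ : Level} {c : ℕ} {𝒮 : Pred Graph ℓ₁} {𝒟 : Pred Graph ℓ₂} (classes : SparseDenseClasses 𝒮 𝒟 c)
  {T₁ T₂ : ℕ → ℕ} (T₁-mono : Monotonic₁ _≤_ _≤_ T₁) (T₂-mono : Monotonic₁ _≤_ _≤_ T₂)
  (recognizable : RecognizableInTime T₁ 𝒮) (enumerable : MISEnumerableInTime T₂ 𝒮)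
  (t : ℕ) (𝒟⊆K̄-free : 𝒟 ⊆ K̄-free (suc t)) where

  open SparseDenseClasses classes

  recogniser = proj₁ recognizable
  enumerator = proj₁ enumerable

  main : Code
  main = mainᶜ c recogniser enumerator (suc t)

  module _ (G : Graph) where

    W = T₁ (order G) + T₂ (order G)

    open Bounds (order G) t

    1≤W : 1 ≤ W
    1≤W with _ , _ , run , k≤ ← proj₂ recognizable G =
      ≤-trans (≤-trans (time-positive run) k≤) (m≤m+n (T₁ (order G)) (T₂ (order G)))

    sparse : VertexSet G → Bool
    sparse X = does (proj₁ (proj₂ recognizable (G [ X ])))

    sparse⁺ : ∀ {X} → 𝒮 (G [ X ]) → sparse X ≡ true
    sparse⁺ {X} = dec-true (proj₁ (proj₂ recognizable (G [ X ])))

    sparse⁻ : ∀ {X} → sparse X ≡ true → 𝒮 (G [ X ])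
    sparse⁻ {X} = does-true (proj₁ (proj₂ recognizable (G [ X ])))

    open Run {M} {W} 2≤M 1≤W

    code⇓ : ∀ {P X y τ} → P ⊢ encodeGraph (G [ X ]) ⇓ y within τ → τ ≤ W →
            code P 0 ⊩ encodeRows (submatrix X X (adjacency G)) ⇓ y
    code⇓ {X = X} (_ , run , k≤) τ≤W
      rewrite submatrix-adjacency G X | sym (encodeGraph≡ (G [ X ])) =
      within-exponent run (≤-trans k≤ (≤-trans τ≤W (≤-reflexive (sym (*-identityʳ W)))))

    open Enumeration (adjacency G)
    open Search (adjacency G) sparse
    open LocalSearch (adjacency G) sparse using (pick-improved-good)

    masks = items (order G) (suc (2 * c))
    its   = items (order G) (suc t)
    S     = pick its (improved masks (order G)) masks

    -- The partition enters the correctness proof alone: `main` and the set S are fixed before it is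
    -- given.
    module _ {S₀ D₀ : VertexSet G} (partition : SparseDensePartition 𝒮 𝒟 G S₀ D₀) where

      outside-S₀ : ∀ {u} → u ∉ S₀ → u ∈ D₀
      outside-S₀ u∉S₀ = [ (λ u∈S₀ → ⊥-elim (u∉S₀ u∈S₀)) , (λ u∈D₀ → u∈D₀) ]′
        (x∈p∪q⁻ S₀ D₀ (subst (_ ∈_) (sym (proj₁ partition)) ∈⊤))

      sparse-outside : ∀ X → sparse X ≡ true → ∣ X ∖ S₀ ∣ ≤ c
      sparse-outside X X-sparse = ≤-trans
        (p⊆q⇒∣p∣≤∣q∣ {p = X ∖ S₀} {q = X ∩ D₀} λ u∈ →
          let u∈X , u∉S₀ = x∈p∖q⁻ X S₀ u∈ in x∈p∩q⁺ (u∈X , outside-S₀ u∉S₀))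
        (∣S∩D∣≤c G X D₀ (sparse⁻ X-sparse) (proj₂ (proj₂ (proj₂ partition))))

      subsets-sparse : ∀ {X} → X ⊆ˢ S₀ → sparse X ≡ true
      subsets-sparse X⊆S₀ = sparse⁺ (sparse-hereditary _ _ ([]-mono-≤ᵢ G X⊆S₀) (proj₁ (proj₂ (proj₂ partition))))

      dense-K̄-free : ∀ A → Independent G A → meets A S₀ ≡ false → ∣ A ∣ ≢ suc t
      dense-K̄-free A independent disjoint ∣A∣≡ =
        𝒟⊆K̄-free (proj₂ (proj₂ (proj₂ partition))) (compress D₀ A)
          (λ {i} {j} i∈ j∈ → independent (∈A i i∈) (∈A j j∈))
          (trans (∣compress∣ D₀ A) (trans (cong ∣_∣ (⊆-antisym (p∩q⊆q D₀ A)
            λ u∈A → x∈p∩q⁺ (outside-S₀ (disjoint⁻ {A = A} disjoint u∈A) , u∈A))) ∣A∣≡))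
        where
        ∈A : ∀ i → i ∈ compress D₀ A → member D₀ i ∈ A
        ∈A i i∈ = true⇒∈ (trans (sym (lookup-compress D₀ A i)) (∈⇒true i∈))

      S-good : sparse S ≡ true × all (harmless S) its ≡ true
      S-good = pick-improved-good c S₀ sparse-outside subsets-sparse its
        (harmless⁺ G (suc t) dense-K̄-free)

      -- The enumerator promises nothing outside `𝒮`, so heredity must supply membership for each
      -- graph on which it is called.
      allowed-sparse : ∀ I → 𝒮 (G [ allowed S I ])
      allowed-sparse I = sparse-hereditary _ _
        ([]-mono-≤ᵢ G (λ u∈ → proj₁ (x∈p∖q⁻ S _ u∈))) (sparse⁻ (proj₁ S-good))

      enumeration : ∀ I → ∃ λ As → ListsMaximalIndependentSets (G [ allowed S I ]) As ×
        enumerator ⊢ encodeGraph (G [ allowed S I ]) ⇓ encodeList encodeSubset As within T₂ ∣ allowed S I ∣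
      enumeration I = proj₂ enumerable (G [ allowed S I ]) (allowed-sparse I)

      enum : ∀ I → List (Subset ∣ allowed S I ∣)
      enum I = proj₁ (enumeration I)

      T₂≤W : ∀ X → T₂ ∣ X ∣ ≤ W
      T₂≤W X = ≤-trans (T₂-mono (∣p∣≤n X)) (m≤n+m (T₂ (order G)) (T₁ (order G)))

      enum≤ : ∀ I → List.length (enum I) ≤ W * M ^ 4
      enum≤ I with As , _ , k , run , k≤ ← enumeration I = begin
        List.length As                       ≤⟨ length≤depth encodeSubset As ⟩
        depth (encodeList encodeSubset As)   ≤⟨ depth-run run ⟩
        depth (encodeGraph (G [ X ])) + k    ≤⟨ +-mono-≤ (depth-encodeGraph (G [ X ])) k≤ ⟩
        ∣ X ∣ + (∣ X ∣ + 1) + T₂ ∣ X ∣       ≤⟨ output≤ (∣p∣≤n X) (T₂≤W X) 1≤W ⟩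
        W * M ^ 4                            ∎
        where
        open ≤-Reasoning
        X = allowed S I

      main-lists : ∃ λ As → ListsMaximalIndependentSets G As ×
        program main ⊢ encodeGraph G ⇓ encodeList encodeSubset As within (W * M ^ exponent main)
      main-lists = lists , collect-lists G S enum (λ I → proj₁ (proj₂ (enumeration I))) (suc t)
                             (harmless⁻ G (suc t) (proj₂ S-good)) ,
        subst (λ x → program main ⊢ x ⇓ encodeList encodeSubset lists within (W * M ^ exponent main))
          (sym (encodeGraph≡ G))
          (_⊩_⇓_.halting (Main.main⇓ 2≤M 1≤W n≤M (adjacency G) c (suc t) recogniser enumerator sparse enum
            (λ X → code⇓ (proj₂ (proj₂ recognizable (G [ X ])))
              (≤-trans (T₁-mono (∣p∣≤n X)) (m≤m+n (T₁ (order G)) (T₂ (order G)))))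
            enum≤
            (λ I → code⇓ (proj₂ (proj₂ (enumeration I))) (T₂≤W (allowed S I)))
            (2^k≤ (suc (2 * c))) 2^t≤ (items-k≤ (suc (2 * c))) items-t≤))
        where
        lists : List (VertexSet G)
        lists = collect S enum its

^-swap : ∀ n t a → (n ^ t) ^ a ≡ n ^ (a * t)
^-swap n t a = trans (^-*-assoc n t a) (cong (n ^_) (*-comm t a))

-- The exponent of mainᶜ depends neither on the programs p, q nor on t in mainᶜ c p q t.
theorem2 : ∀ {ℓ₁ ℓ₂} (c : ℕ) → ∃ λ (a : ℕ) →
    (𝒮 : Pred Graph ℓ₁) (𝒟 : Pred Graph ℓ₂) → SparseDenseClasses 𝒮 𝒟 c →
    (T₁ T₂ : ℕ → ℕ) → Monotonic₁ _≤_ _≤_ T₁ → Monotonic₁ _≤_ _≤_ T₂ →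
    RecognizableInTime T₁ 𝒮 → MISEnumerableInTime T₂ 𝒮 →
    (t : ℕ) → 𝒟 ⊆ K̄-free t →
    ∃ λ (τ : ℕ → ℕ) → MISEnumerableInTime τ (SparseDense 𝒮 𝒟) ×
      (∀ n → 2 ≤ n → τ n ≤ (T₁ n + T₂ n) * n ^ (a * t))
theorem2 c = exponent (mainᶜ c nil nil 0) , λ where
  -- For t = 0 the empty set is an independent set of size t, so `𝒟` is empty and no graph is
  -- sparse-dense.
  𝒮 𝒟 classes T₁ T₂ T₁-mono T₂-mono recognizable enumerable zero 𝒟⊆K̄-free →
    (λ _ → 0) ,
    (nil , λ { G (_ , D , _ , _ , _ , D-dense) →
      ⊥-elim (𝒟⊆K̄-free D-dense ⊥ (λ u∈⊥ → ⊥-elim (∉⊥ u∈⊥)) (∣⊥∣≡0 ∣ D ∣)) }) ,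
    λ _ _ → z≤n
  𝒮 𝒟 classes T₁ T₂ T₁-mono T₂-mono recognizable enumerable (suc t) 𝒟⊆K̄-free →
    let open Enumerator classes T₁-mono T₂-mono recognizable enumerable t 𝒟⊆K̄-free in
    (λ n → (T₁ n + T₂ n) * Bounds.M n t ^ exponent main) ,
    (program main , λ { G (_ , _ , partition) → main-lists G partition }) ,
    -- For n ≥ 2 the maximum inside M is n, and the bound holds with equality.
    λ n 2≤n → ≤-reflexive (cong ((T₁ n + T₂ n) *_) (trans
      (cong (λ b → (b ^ suc t) ^ exponent main) (m≥n⇒m⊔n≡m 2≤n))
      (^-swap n (suc t) (exponent main))))
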